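{- For each integer $k\ge1$ let $S^{(2)}_k=\bigl(S^{(2)}(n+k-1,k)\bigr)_{n\ge1}$ be the sequence of Stirling numbers of the second kind. Then: (i) for $k\in\{1,2\}$ the sequence $S^{(2)}_k$ is realizable; (ii) for every $k\ge3$ the sequence $S^{(2)}_k$ is not realizable, but is almost realizable; (iii) for every $k\ge1$, $\mathrm{Fail}\bigl(S^{(2)}_k\bigr)$ divides $(k-1)!$.
   Context: For $n\ge 1$ and $1\le k\le n$, $S^{(2)}(n,k)$ denotes the Stirling number of the second kind: the number of ways to partition a set with $n$ elements into $k$ non-empty subsets. For $k\ge1$, $S^{(2)}_k$ is the sequence whose $n$-th term ($n\ge1$) is $S^{(2)}(n+k-1,k)$; for example $S^{(2)}_3=(1,6,25,90,\dots)$. For an integer sequence $A=(A_n)_{n\ge1}$ write $(\mu*A)(n)=\sum_{d\mid n}\mu(n/d)A_d$, where $\mu$ is the classical Möbius function. The sequence $A$ is called realizable if either of the following two equivalent conditions holds: (a) there is a map $T\colon X\to X$ on a set $X$ with $A_n=|\{x\in X\mid T^nx=x\}|$ for all $n\ge1$; (b) $A$ satisfies both the Dold condition $n\mid(\mu*A)(n)$ for all $n\ge1$ and the sign condition $(\mu*A)(n)\ge0$ for all $n\ge1$. For a rational number $x$, $\mathrm{Denom}(x)$ denotes the (positive) denominator of $x$ written in lowest terms. For a sequence $A$ of non-negative integers define $$\mathrm{Fail}(A)=\mathrm{lcm}\bigl(\{\mathrm{Denom}\bigl(\tfrac1n(\mu*A)(n)\bigr)\mid n\ge1\}\bigr)$$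 if this is finite, and $\mathrm{Fail}(A)=\infty$ otherwise. The sequence $A$ is called almost realizable if $\mathrm{Fail}(A)<\infty$ and $A$ satisfies the sign condition $(\mu*A)(n)\ge0$ for all $n\ge1$. -}

module Defs where

open import Data.Bool.Base using (if_then_else_)
open import Data.Bool.Properties using () renaming (_≟_ to _≟ᵇ_)
open import Data.Empty using (⊥)
open import Data.Fin.Subset using (Subset; inside; outside; Nonempty; Empty; _∩_; ⋃; ⊤)
open import Data.Fin.Subset.Properties using (nonempty?)
open import Data.Integer.Base as ℤ using (ℤ; +_; 0ℤ; -1ℤ)
open import Data.Integer.Divisibility as ℤ using ()
open import Data.List.Base using (List; []; _∷_; _++_; map; filter; foldr; length; upTo)
open import Data.List.Relation.Unary.All as All using (All)
open import Data.List.Relation.Unary.AllPairs as AllPairs using (AllPairs)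
open import Data.List.Relation.Unary.Any as Any using ()
open import Data.Nat.Base
open import Data.Nat.Divisibility using (_∣_; _∣?_; ∣⇒≤; ∣-antisym)
open import Data.Nat.GCD using (gcd; gcd[m,n]∣m; gcd[m,n]∣n; gcd-greatest; gcd[m,n]≢0)
open import Data.Nat.Induction using (<-wellFounded)
open import Data.Nat.Primality using (prime?)
open import Data.Nat.Properties using (_≟_; m≤n⇒m<n∨m≡n)
open import Data.Product.Base using (_×_; _,_; ∃-syntax)
open import Data.Rational.Base as ℚ using (ℚ)
open import Data.Sum.Base using (inj₁; inj₂)
open import Data.Vec.Base as Vec using ()
open import Data.Vec.Properties using (≡-dec)
open import Induction.WellFounded using (Acc; acc)
open import Relation.Binary.PropositionalEquality using (_≡_; refl; cong; subst)
open import Relation.Nullary using (¬_; Dec; does; ¬?; _×-dec_; contradiction)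
open import Relation.Nullary.Construct.Add.Supremum using (_⁺; [_]) renaming (⊤⁺ to ∞)

allSubsets : ∀ n → List (Subset n)
allSubsets zero    = Vec.[] ∷ []
allSubsets (suc n) = map (outside Vec.∷_) (allSubsets n) ++ map (inside Vec.∷_) (allSubsets n)

sublists : ∀ {a} {A : Set a} → List A → List (List A)
sublists []       = [] ∷ []
sublists (x ∷ xs) = sublists xs ++ map (x ∷_) (sublists xs)

IsPartition : ∀ n → ℕ → List (Subset n) → Set
IsPartition n k π =
  length π ≡ k × All Nonempty π × AllPairs (λ p q → Empty (p ∩ q)) π × ⋃ π ≡ ⊤

isPartition? : ∀ n k (π : List (Subset n)) → Dec (IsPartition n k π)
isPartition? n k π =
  (length π ≟ k) ×-dec All.all? nonempty? π
    ×-dec AllPairs.allPairs? (λ p q → ¬? (nonempty? (p ∩ q))) π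
    ×-dec ≡-dec _≟ᵇ_ (⋃ π) ⊤

-- `allSubsets n` has no repetitions, so each set of subsets of `Fin n` is
-- represented by exactly one sublist of it.
partitions : ∀ n → ℕ → List (List (Subset n))
partitions n k = filter (isPartition? n k) (sublists (allSubsets n))

stirling₂ : ℕ → ℕ → ℕ
stirling₂ n k = length (partitions n k)

-- A sequence (A_n)_{n ≥ 1} is a function on ℕ whose value at 0 is never used.
Sequence : Set
Sequence = ℕ → ℤ

S⁽²⁾ : ℕ → Sequence
S⁽²⁾ k n = + stirling₂ (n + k ∸ 1) k

primeDivisors : ℕ → List ℕ
primeDivisors n = filter (λ p → prime? p ×-dec p ∣? n) (upTo (suc n))

μ : ℕ → ℤ
μ n = if does (Any.any? (λ p → p * p ∣? n) (primeDivisors n))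
      then 0ℤ
      else -1ℤ ℤ.^ length (primeDivisors n)

-- The index i stands for the divisor d = suc i of n.
μ* : Sequence → Sequence
μ* A n = foldr ℤ._+_ 0ℤ
  (map (λ i → μ (n / suc i) ℤ.* A (suc i)) (filter (λ i → suc i ∣? n) (upTo n)))

Dold : Sequence → Set
Dold A = ∀ n → .{{NonZero n}} → + n ℤ.∣ μ* A n

Sign : Sequence → Set
Sign A = ∀ n → .{{NonZero n}} → 0ℤ ℤ.≤ μ* A n

Realizable : Sequence → Set
Realizable A = Dold A × Sign A

Denom : ℚ → ℕ
Denom = ℚ.denominatorℕ

CommonMultiple : Sequence → ℕ → Set
CommonMultiple A m = ∀ n → .{{_ : NonZero n}} → Denom (μ* A n ℚ./ n) ∣ m

-- A set of positive integers has a finite lcm exactly when it has a positive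
-- common multiple.
FailFinite : Sequence → Set
FailFinite A = ∃[ m ] (NonZero m × CommonMultiple A m)

-- The graph of A ↦ Fail(A).  The lcm of an infinite set need not be computable, so
-- Fail is given as a relation; `IsFail-unique` and `IsFail-total` show that it
-- is (classically) a function.
IsFail : Sequence → ℕ ⁺ → Set
IsFail A [ f ] = NonZero f × CommonMultiple A f × (∀ m → CommonMultiple A m → f ∣ m)
IsFail A ∞     = ¬ FailFinite A

infix 4 _∣⁺_

_∣⁺_ : ℕ ⁺ → ℕ → Set
[ f ] ∣⁺ m = f ∣ m
∞     ∣⁺ m = ⊥

AlmostRealizable : Sequence → Set
AlmostRealizable A = FailFinite A × Sign A

IsFail-unique : ∀ A f g → IsFail A f → IsFail A g → f ≡ g
IsFail-unique A [ f ] [ g ] (_ , cf , lf) (_ , cg , lg) =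
  cong [_] (∣-antisym (lf g cg) (lg f cf))
IsFail-unique A [ f ] ∞     (nz , cf , _) ¬fin = contradiction (f , nz , cf) ¬fin
IsFail-unique A ∞     [ g ] ¬fin (nz , cg , _) = contradiction (g , nz , cg) ¬fin
IsFail-unique A ∞     ∞     _ _ = refl

IsFail-total : ∀ A → ¬ ¬ (∃[ f ] IsFail A f)
IsFail-total A none = none (∞ , λ (m , nz , cm) → descend m (<-wellFounded m) nz cm)
  where
  descend : ∀ m → Acc _<_ m → NonZero m → ¬ CommonMultiple A m
  descend m (acc rec) nz cm = none ([ m ] , nz , cm , least)
    where
    least : ∀ c → CommonMultiple A c → m ∣ c
    least c cc with m≤n⇒m<n∨m≡n (∣⇒≤ {{nz}} (gcd[m,n]∣m m c))
    ... | inj₂ g≡m = subst (_∣ c) g≡m (gcd[m,n]∣n m c)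
    ... | inj₁ g<m = contradiction common (descend (gcd m c) (rec g<m) g≢0)
      where
      g≢0 : NonZero (gcd m c)
      g≢0 = ≢-nonZero (gcd[m,n]≢0 m c (inj₁ (≢-nonZero⁻¹ m {{nz}})))

      common : CommonMultiple A (gcd m c)
      common n = gcd-greatest (cm n) (cc n)

{-# OPTIONS --safe #-}
module Submission where

-- Write k = K + 1.  The recurrence for Stirling numbers of the second kind gives
-- K! S(n + K, K + 1) = Δᴷ[x ↦ xⁿ⁺ᴷ⁻¹](1) by the Leibniz rule for the K-th finite difference.
-- For K ≥ 1 the right side is, as a sequence in n, an integer combination of the sequences
-- xⁿ, and for K = 0 it is constant.  These satisfy the Dold condition by Euler's congruence
-- x^(pᵉ⁺¹) ≡ x^(pᵉ) mod pᵉ⁺¹, so n ∣ K! (μ * A)(n) and Fail divides K!.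
-- For k ≥ 2 the sign condition follows from A (n + 1) ≥ 2 A n, which makes the leading term
-- of μ * A outweigh the others.
-- For k ≥ 3 the Dold condition fails at a power of 2: with s = ⌊(k − 1) / 2⌋, the number
-- S(n + k, k) has the parity of the binomial coefficient (n + s) C s, and the parities at
-- n = 2ᵉ − 1 and n = 2ᵉ⁺¹ − 1 differ when 2ᵉ is the exact power of 2 dividing s.

open import Defs
open import Data.Nat using (ℕ; _∸_; _≤_; _!)
open import Data.Product using (_×_)
open import Data.Sum using (_⊎_)
open import Relation.Binary.PropositionalEquality using (_≡_)
open import Relation.Nullary using (¬_)

import Algebra.Properties.CommutativeSemigroup as CommutativeSemigroup
open import Data.Bool.Base using (if_then_else_; true; false)
open import Data.Fin.Base as Fin using ()
open import Data.Fin.Subset using (Subset; inside; outside; Nonempty; Empty; _∩_; ⋃; ⊤)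
  renaming (_∪_ to _∪ˢ_)
open import Data.Fin.Subset.Properties
  using (nonempty?; Empty-unique; ∪-identityˡ; ∪-assoc; ∪-comm; ∩-comm; ∩-idem; x∈p∩q⁻)
open import Data.Integer.Base as ℤ using (ℤ; +_; -[1+_]; 0ℤ; 1ℤ; -1ℤ)
open import Data.Integer.Divisibility.Signed as ∣ᶻ using () renaming (_∣_ to _∣ᶻ_)
import Data.Integer.Properties as ℤ
import Data.Integer.Tactic.RingSolver as ℤ-Solver
open import Data.List.Base using (List; []; _∷_; _++_; map; filter; foldr; length; upTo)
open import Data.List.Membership.Propositional using (_∈_; lose; find)
open import Data.List.Membership.Propositional.Properties
  using (∈-filter⁺; ∈-filter⁻; ∈-upTo⁺; ∈-map⁺; ∈-map⁻; ∈-++⁺ˡ; ∈-++⁺ʳ; ∈-++⁻)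
open import Data.List.Membership.Propositional.Properties.WithK using (unique∧set⇒bag)
open import Data.List.Properties
  using (length-map; map-++; map-∘; map-cong; filter-++; filter-accept; filter-reject; upTo-∷ʳ)
open import Data.List.Relation.Binary.BagAndSetEquality using (∼bag⇒↭)
open import Data.List.Relation.Binary.Permutation.Propositional
  using (_↭_; prep; swap; ↭-sym; ↭⇒↭ₛ) renaming (refl to ↭refl; trans to ↭trans)
open import Data.List.Relation.Binary.Permutation.Propositional.Properties
  using (All-resp-↭; ↭-length; ++-comm; map⁺)
open import Data.List.Relation.Binary.Permutation.Setoid.Properties using (foldr-commMonoid)
open import Data.List.Relation.Unary.All as All using (All; []; _∷_)
import Data.List.Relation.Unary.All.Properties as All
open import Data.List.Relation.Unary.AllPairs as AllPairs using (AllPairs; []; _∷_)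
import Data.List.Relation.Unary.AllPairs.Properties as AllPairs
open import Data.List.Relation.Unary.Any as Any using (here; there)
open import Data.List.Relation.Unary.Unique.Propositional using (Unique)
import Data.List.Relation.Unary.Unique.Propositional.Properties as Unique
open import Data.Nat.Base as ℕ
open import Data.Nat.Combinatorics
  using (_C_; nCn≡1; nCk+nC[k+1]≡[n+1]C[k+1]; k![n∸k]!∣n!; nCk≡n!/k![n-k]!; k>n⇒nCk≡0)
open import Data.Nat.Coprimality as Coprimality using (Coprime)
open import Data.Nat.Divisibility
open import Data.Nat.DivMod using (m*n/n≡m; m/n*n≡m; n/n≡1)
open import Data.Nat.GCD using (gcd; gcd[m,n]≢0)
open import Data.Nat.Induction using (<-rec)
open import Data.Nat.ListAction using (sum; product)
open import Data.Nat.ListAction.Properties using (sum-++)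
open import Data.Nat.Primality
open import Data.Nat.Primality.Factorisation using (factorise; module PrimeFactorisation)
open import Data.Nat.Properties
open import Data.Nat.Tactic.RingSolver using (solve-∀)
open import Data.Parity.Base as ℙ using (Parity; 0ℙ; 1ℙ)
import Data.Parity.Properties as ℙ
open import Data.Product using (_,_; proj₁; proj₂; ∃-syntax)
open import Data.Rational.Base as ℚ using (mkℚ)
import Data.Rational.Properties as ℚ
open import Data.Sum using (inj₁; inj₂)
open import Data.Vec.Base as Vec using ()
import Data.Vec.Properties as Vec
open import Function using (_∘_; mk⇔)
open import Relation.Binary.PropositionalEquality
  using (_≢_; refl; sym; trans; cong; cong₂; subst; subst₂; setoid; module ≡-Reasoning)
open import Relation.Nullary using (Dec; yes; no; does; ¬?; _×-dec_; _⊎-dec_; contradiction)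
open import Relation.Nullary.Construct.Add.Supremum using ([_]) renaming (⊤⁺ to ∞)
open import Relation.Nullary.Decidable using (dec-true)
open import Relation.Unary using (Pred; Decidable)

open CommutativeSemigroup +-commutativeSemigroup using () renaming (interchange to +-interchange)
open CommutativeSemigroup *-commutativeSemigroup using () renaming (x∙yz≈y∙xz to *-x∙yz≈y∙xz)

-- Because `stirling₂` counts filtered lists, its recurrence has to be extracted from the
-- enumeration. Deleting 0 from its block is a bijection only up to the order of the blocks, so
-- counts become sums of 0/1 weights over sublists, with weights invariant under permutation. The
-- factor k of the recurrence comes from a double count of partitions with a marked block. The bound
-- is (k - 1)! rather than k! because the finite difference is taken at 1: Δᵏ[x · xᴺ](0) = k
-- Δᵏ⁻¹[xᴺ](1), which cancels a factor k from the classical formula at 0. The Dold condition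
-- concerns all n, Euler's congruence a single prime. They meet in an identity that turns μ * A at
-- pᵉ⁺¹ m, for m prime to p, into the transform at m of d ↦ A (pᵉ⁺¹ d) - A (pᵉ d). The parity claim
-- reflects the generating function ∏ 1 / (1 - j x), 1 ≤ j ≤ k: modulo 2 only the s + 1 odd values
-- of j survive, which leaves 1 / (1 - x)ˢ⁺¹. For k = 1 the sequence is constant and does not
-- double, so its sign condition is proved separately, by induction on n.

private variable
  A B P Q : Set

-- Sums over sublists

⟦_⟧ : Dec P → ℕ
⟦ P? ⟧ = if does P? then 1 else 0

⟦⟧-cong : (P → Q) → (Q → P) → (P? : Dec P) (Q? : Dec Q) → ⟦ P? ⟧ ≡ ⟦ Q? ⟧
⟦⟧-cong f g (yes p) (yes q) = refl
⟦⟧-cong f g (yes p) (no ¬q) = contradiction (f p) ¬q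
⟦⟧-cong f g (no ¬p) (yes q) = contradiction (g q) ¬p
⟦⟧-cong f g (no ¬p) (no ¬q) = refl

⟦⟧-no : ¬ P → (P? : Dec P) → ⟦ P? ⟧ ≡ 0
⟦⟧-no ¬p (yes p) = contradiction p ¬p
⟦⟧-no ¬p (no _)  = refl

⟦⟧-× : (P? : Dec P) (Q? : Dec Q) → ⟦ P? ×-dec Q? ⟧ ≡ ⟦ P? ⟧ * ⟦ Q? ⟧
⟦⟧-× (yes _) (yes _) = refl
⟦⟧-× (yes _) (no _)  = refl
⟦⟧-× (no _)  _       = refl

⟦⟧-⊎ : ¬ (P × Q) → (P? : Dec P) (Q? : Dec Q) → ⟦ P? ⊎-dec Q? ⟧ ≡ ⟦ P? ⟧ + ⟦ Q? ⟧
⟦⟧-⊎ ¬pq (yes p) (yes q) = contradiction (p , q) ¬pq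
⟦⟧-⊎ ¬pq (yes _) (no _)  = refl
⟦⟧-⊎ ¬pq (no _)  (yes _) = refl
⟦⟧-⊎ ¬pq (no _)  (no _)  = refl

⟦⟧-*-cong : {m n : ℕ} → (P → m ≡ n) → (P? : Dec P) → ⟦ P? ⟧ * m ≡ ⟦ P? ⟧ * n
⟦⟧-*-cong f (yes p) = cong (1 *_) (f p)
⟦⟧-*-cong f (no _)  = refl

length-filter≡sum : {P : Pred A _} (P? : Decidable P) (xs : List A) →
                    length (filter P? xs) ≡ sum (map (λ x → ⟦ P? x ⟧) xs)
length-filter≡sum P? [] = refl
length-filter≡sum P? (x ∷ xs) with does (P? x)
... | true  = cong suc (length-filter≡sum P? xs)
... | false = length-filter≡sum P? xs

sum-map-+ : (f g : A → ℕ) (xs : List A) →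
            sum (map (λ x → f x + g x) xs) ≡ sum (map f xs) + sum (map g xs)
sum-map-+ f g [] = refl
sum-map-+ f g (x ∷ xs) rewrite sum-map-+ f g xs =
  +-interchange (f x) (g x) (sum (map f xs)) (sum (map g xs))

sum-map-*ʳ : (f : A → ℕ) (c : ℕ) (xs : List A) → sum (map (λ x → f x * c) xs) ≡ sum (map f xs) * c
sum-map-*ʳ f c [] = refl
sum-map-*ʳ f c (x ∷ xs) rewrite sum-map-*ʳ f c xs = sym (*-distribʳ-+ c (f x) _)

-- A chosen element is absorbed into the weight instead of being consed onto a list of results, so a
-- sum over `xs ++ ys` unfolds into a nested sum by plain induction.
Σ⊆ : List A → (List A → ℕ) → ℕ
Σ⊆ []       w = w []
Σ⊆ (x ∷ xs) w = Σ⊆ xs w + Σ⊆ xs (w ∘ (x ∷_))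

sum-sublists : (w : List A → ℕ) (xs : List A) → sum (map w (sublists xs)) ≡ Σ⊆ xs w
sum-sublists w [] = +-identityʳ (w [])
sum-sublists w (x ∷ xs)
  rewrite map-++ w (sublists xs) (map (x ∷_) (sublists xs))
        | sum-++ (map w (sublists xs)) (map w (map (x ∷_) (sublists xs)))
        | sym (map-∘ {g = w} {f = x ∷_} (sublists xs))
  = cong₂ _+_ (sum-sublists w xs) (sum-sublists (w ∘ (x ∷_)) xs)

Σ⊆-cong : {v w : List A → ℕ} → (∀ a → v a ≡ w a) → ∀ xs → Σ⊆ xs v ≡ Σ⊆ xs w
Σ⊆-cong v≡w []       = v≡w []
Σ⊆-cong v≡w (x ∷ xs) = cong₂ _+_ (Σ⊆-cong v≡w xs) (Σ⊆-cong (λ a → v≡w (x ∷ a)) xs)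

Σ⊆-+ : (v w : List A → ℕ) (xs : List A) → Σ⊆ xs (λ a → v a + w a) ≡ Σ⊆ xs v + Σ⊆ xs w
Σ⊆-+ v w [] = refl
Σ⊆-+ v w (x ∷ xs) rewrite Σ⊆-+ v w xs | Σ⊆-+ (v ∘ (x ∷_)) (w ∘ (x ∷_)) xs =
  +-interchange (Σ⊆ xs v) (Σ⊆ xs w) (Σ⊆ xs (v ∘ (x ∷_))) (Σ⊆ xs (w ∘ (x ∷_)))

Σ⊆-*ʳ : (w : List A → ℕ) (c : ℕ) (xs : List A) → Σ⊆ xs (λ a → w a * c) ≡ Σ⊆ xs w * c
Σ⊆-*ʳ w c [] = refl
Σ⊆-*ʳ w c (x ∷ xs) rewrite Σ⊆-*ʳ w c xs | Σ⊆-*ʳ (w ∘ (x ∷_)) c xs =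
  sym (*-distribʳ-+ c (Σ⊆ xs w) _)

Σ⊆-zero : {w : List A → ℕ} → (∀ a → w a ≡ 0) → ∀ xs → Σ⊆ xs w ≡ 0
Σ⊆-zero w≡0 []       = w≡0 []
Σ⊆-zero w≡0 (x ∷ xs) = cong₂ _+_ (Σ⊆-zero w≡0 xs) (Σ⊆-zero (λ a → w≡0 (x ∷ a)) xs)

Σ⊆-sum : (w : A → List B → ℕ) (xs : List B) (ys : List A) →
         Σ⊆ xs (λ a → sum (map (λ y → w y a) ys)) ≡ sum (map (λ y → Σ⊆ xs (w y)) ys)
Σ⊆-sum w xs []       = Σ⊆-zero (λ _ → refl) xs
Σ⊆-sum w xs (y ∷ ys) =
  trans (Σ⊆-+ (w y) _ xs) (cong (Σ⊆ xs (w y) ℕ.+_) (Σ⊆-sum w xs ys))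

Σ⊆-++ : (w : List A → ℕ) (xs ys : List A) → Σ⊆ (xs ++ ys) w ≡ Σ⊆ xs (λ a → Σ⊆ ys (λ b → w (a ++ b)))
Σ⊆-++ w []       ys = refl
Σ⊆-++ w (x ∷ xs) ys = cong₂ _+_ (Σ⊆-++ w xs ys) (Σ⊆-++ (w ∘ (x ∷_)) xs ys)

Σ⊆-map : (f : A → B) (w : List B → ℕ) (xs : List A) → Σ⊆ (map f xs) w ≡ Σ⊆ xs (w ∘ map f)
Σ⊆-map f w []       = refl
Σ⊆-map f w (x ∷ xs) = cong₂ _+_ (Σ⊆-map f w xs) (Σ⊆-map f (w ∘ (f x ∷_)) xs)

Σ⊆-empty : {w : List A → ℕ} → (∀ x a → w (x ∷ a) ≡ 0) → ∀ xs → Σ⊆ xs w ≡ w []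
Σ⊆-empty w∷≡0 [] = refl
Σ⊆-empty w∷≡0 (x ∷ xs) =
  trans (cong₂ _+_ (Σ⊆-empty w∷≡0 xs) (Σ⊆-zero (w∷≡0 x) xs)) (+-identityʳ _)

-- Meant for the blocks containing 0: without one, 0 is uncovered, and two of them overlap.
Σ⊆-singletons : {w : List A → ℕ} → w [] ≡ 0 → (∀ x y a → w (x ∷ y ∷ a) ≡ 0) →
                ∀ xs → Σ⊆ xs w ≡ sum (map (λ x → w (x ∷ [])) xs)
Σ⊆-singletons w[]≡0 w∷∷≡0 [] = w[]≡0
Σ⊆-singletons {w = w} w[]≡0 w∷∷≡0 (x ∷ xs) =
  trans (cong₂ _+_ (Σ⊆-singletons w[]≡0 w∷∷≡0 xs) (Σ⊆-empty (w∷∷≡0 x) xs))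
        (+-comm _ (w (x ∷ [])))

-- Both sides count the sublists of xs with a marked element.
Σ⊆-marked : (w : List A → ℕ) → (∀ {a b} → a ↭ b → w a ≡ w b) → (∀ x a → w (x ∷ x ∷ a) ≡ 0) →
            ∀ xs → sum (map (λ x → Σ⊆ xs (w ∘ (x ∷_))) xs) ≡ Σ⊆ xs (λ a → w a * length a)
Σ⊆-marked w w-↭ w-dup [] = sym (*-zeroʳ (w []))
Σ⊆-marked w w-↭ w-dup (x ∷ xs) = begin
  Σ⊆ xs wₓ + Σ⊆ xs (wₓ ∘ (x ∷_)) + sum (map (λ y → Σ⊆ xs (w ∘ (y ∷_)) + Σ⊆ xs (w ∘ (y ∷_) ∘ (x ∷_))) xs)
    -- With x marked, the rest of the selection still ranges over sublists that may contain x again;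
    -- those have weight 0 by `w-dup`. With y from `xs` marked, the sum splits on whether x is
    -- selected.
    ≡⟨ cong₂ _+_ (cong (Σ⊆ xs wₓ ℕ.+_) (Σ⊆-zero (w-dup x) xs)) (sum-map-+ _ _ xs) ⟩
  Σ⊆ xs wₓ + 0 + (sum (map (λ y → Σ⊆ xs (w ∘ (y ∷_))) xs) + sum (map (λ y → Σ⊆ xs (w ∘ (y ∷_) ∘ (x ∷_))) xs))
    ≡⟨ cong (λ z → Σ⊆ xs wₓ + 0 + (sum (map (λ y → Σ⊆ xs (w ∘ (y ∷_))) xs) + z))
         (cong sum (map-cong (λ y → Σ⊆-cong (λ a → w-↭ (swap y x ↭refl)) xs) xs)) ⟩
  Σ⊆ xs wₓ + 0 + (sum (map (λ y → Σ⊆ xs (w ∘ (y ∷_))) xs) + sum (map (λ y → Σ⊆ xs (wₓ ∘ (y ∷_))) xs))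
    ≡⟨ cong (Σ⊆ xs wₓ + 0 ℕ.+_) (cong₂ _+_ (Σ⊆-marked w w-↭ w-dup xs) (Σ⊆-marked wₓ (w-↭ ∘ prep x) wₓ-dup xs)) ⟩
  Σ⊆ xs wₓ + 0 + (Σ⊆ xs (λ a → w a * length a) + Σ⊆ xs (λ a → wₓ a * length a))
    ≡⟨ rearrange (Σ⊆ xs wₓ) (Σ⊆ xs (λ a → w a * length a)) (Σ⊆ xs (λ a → wₓ a * length a)) ⟩
  Σ⊆ xs (λ a → w a * length a) + (Σ⊆ xs wₓ + Σ⊆ xs (λ a → wₓ a * length a))
    ≡⟨ cong (Σ⊆ xs (λ a → w a * length a) ℕ.+_) (Σ⊆-+ wₓ _ xs) ⟨
  Σ⊆ xs (λ a → w a * length a) + Σ⊆ xs (λ a → wₓ a + wₓ a * length a)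
    ≡⟨ cong (Σ⊆ xs (λ a → w a * length a) ℕ.+_) (Σ⊆-cong (λ a → sym (*-suc (wₓ a) (length a))) xs) ⟩
  Σ⊆ xs (λ a → w a * length a) + Σ⊆ xs (λ a → wₓ a * suc (length a)) ∎
  where
  open ≡-Reasoning
  wₓ = w ∘ (x ∷_)

  wₓ-dup : ∀ y a → wₓ (y ∷ y ∷ a) ≡ 0
  wₓ-dup y a = trans (w-↭ (↭trans (swap x y ↭refl) (prep y (swap x y ↭refl)))) (w-dup y (x ∷ a))

  rearrange : ∀ a b c → a + 0 + (b + c) ≡ b + (a + c)
  rearrange = solve-∀

-- Set partitions

module _ {n : ℕ} where

  Disjoint : Subset n → Subset n → Set
  Disjoint p q = Empty (p ∩ q)

  Disjoint-sym : ∀ {p q} → Disjoint p q → Disjoint q p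
  Disjoint-sym {p} {q} = subst Empty (∩-comm p q)

  AllPairs-↭ : ∀ {π ρ} → π ↭ ρ → AllPairs Disjoint π → AllPairs Disjoint ρ
  AllPairs-↭ ↭refl ps = ps
  AllPairs-↭ (prep x r) (p ∷ ps) = All-resp-↭ r p ∷ AllPairs-↭ r ps
  AllPairs-↭ (swap x y r) ((xy ∷ xs) ∷ ys ∷ ps) =
    (Disjoint-sym {x} {y} xy ∷ All-resp-↭ r ys) ∷ All-resp-↭ r xs ∷ AllPairs-↭ r ps
  AllPairs-↭ (↭trans r s) ps = AllPairs-↭ s (AllPairs-↭ r ps)

  ⋃-↭ : ∀ {π ρ : List (Subset n)} → π ↭ ρ → ⋃ π ≡ ⋃ ρ
  ⋃-↭ ↭refl = refl
  ⋃-↭ (prep x r) = cong (x ∪ˢ_) (⋃-↭ r)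
  ⋃-↭ (swap {xs} {ys} x y r) = begin
    x ∪ˢ (y ∪ˢ ⋃ xs) ≡⟨ ∪-assoc x y _ ⟨
    (x ∪ˢ y) ∪ˢ ⋃ xs ≡⟨ cong₂ _∪ˢ_ (∪-comm x y) (⋃-↭ r) ⟩
    (y ∪ˢ x) ∪ˢ ⋃ ys ≡⟨ ∪-assoc y x _ ⟩
    y ∪ˢ (x ∪ˢ ⋃ ys) ∎
    where open ≡-Reasoning
  ⋃-↭ (↭trans r s) = trans (⋃-↭ r) (⋃-↭ s)

  -- A selection lists its blocks in the order of `allSubsets`, whereas the block of 0 has to be
  -- moved to the front and a marked block taken out.
  IsPartition-↭ : ∀ {k π ρ} → π ↭ ρ → IsPartition n k π → IsPartition n k ρ
  IsPartition-↭ r (len , ne , dis , cover) =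
    trans (sym (↭-length r)) len , All-resp-↭ r ne , AllPairs-↭ r dis , trans (sym (⋃-↭ r)) cover

  ¬IsPartition-dup : ∀ {k} p π → ¬ IsPartition n k (p ∷ p ∷ π)
  ¬IsPartition-dup p π (_ , ne ∷ _ , (dis ∷ _) ∷ _ , _) = dis (subst Nonempty (sym (∩-idem p)) ne)

  out inn : List (Subset n) → List (Subset (suc n))
  out = map (outside Vec.∷_)
  inn = map (inside Vec.∷_)

  nonempty-out⁺ : {p : Subset n} → Nonempty p → Nonempty (outside Vec.∷ p)
  nonempty-out⁺ (i , i∈p) = Fin.suc i , Vec.there i∈p

  nonempty-out⁻ : {p : Subset n} → Nonempty (outside Vec.∷ p) → Nonempty p
  nonempty-out⁻ (Fin.suc i , Vec.there i∈p) = i , i∈p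

  nonempty-inn : {p : Subset n} → Nonempty (inside Vec.∷ p)
  nonempty-inn = Fin.zero , Vec.here

  ⋃-out : ∀ π → ⋃ (out π) ≡ outside Vec.∷ ⋃ π
  ⋃-out []      = refl
  ⋃-out (p ∷ π) rewrite ⋃-out π = refl

  ¬IsPartition-out : ∀ {k} π → ¬ IsPartition (suc n) k (out π)
  ¬IsPartition-out π (_ , _ , _ , cover) with trans (sym (⋃-out π)) cover
  ... | ()

  ¬IsPartition-inn² : ∀ {k} p q π → ¬ IsPartition (suc n) k ((inside Vec.∷ p) ∷ (inside Vec.∷ q) ∷ π)
  ¬IsPartition-inn² p q π (_ , _ , (dis ∷ _) ∷ _ , _) = dis nonempty-inn

  -- Removing 0 from its block leaves a block, or nothing if 0 was a singleton block.
  IsPartition-inn⁻ : ∀ {k} p π → IsPartition (suc n) (suc k) ((inside Vec.∷ p) ∷ out π) →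
                     IsPartition n (suc k) (p ∷ π) ⊎ (Empty p × IsPartition n k π)
  IsPartition-inn⁻ p π (len , _ ∷ ne , dis₀ ∷ dis , cover) = go (nonempty? p)
    where
    len′ = trans (sym (length-map (outside Vec.∷_) π)) (suc-injective len)
    ne′ = All.map nonempty-out⁻ (All.map⁻ ne)
    dis₀′ = All.map (λ d → d ∘ nonempty-out⁺) (All.map⁻ dis₀)
    dis′ = AllPairs.map (λ d → d ∘ nonempty-out⁺) (AllPairs.map⁻ dis)

    cover′ : p ∪ˢ ⋃ π ≡ ⊤
    cover′ = Vec.∷-injectiveʳ (trans (cong ((inside Vec.∷ p) ∪ˢ_) (sym (⋃-out π))) cover)

    go : Dec (Nonempty p) → _
    go (yes p≢∅) = inj₁ (cong suc len′ , p≢∅ ∷ ne′ , dis₀′ ∷ dis′ , cover′)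
    go (no p≡∅)  = inj₂ (p≡∅ , len′ , ne′ , dis′ ,
      trans (sym (trans (cong (_∪ˢ ⋃ π) (Empty-unique p≡∅)) (∪-identityˡ (⋃ π)))) cover′)

  -- The element 0 itself makes the new block nonempty, so p may be a former block or empty; both
  -- cases of `IsPartition-inn⁺` go through here.
  IsPartition-addZero : ∀ {k} p π → length π ≡ k → All Nonempty π → All (Disjoint p) π →
                     AllPairs Disjoint π → p ∪ˢ ⋃ π ≡ ⊤ →
                     IsPartition (suc n) (suc k) ((inside Vec.∷ p) ∷ out π)
  IsPartition-addZero p π len ne dis₀ dis cover =
    cong suc (trans (length-map _ π) len) ,
    nonempty-inn ∷ All.map⁺ (All.map nonempty-out⁺ ne) ,
    All.map⁺ (All.map (λ d → d ∘ nonempty-out⁻) dis₀) ∷ AllPairs.map⁺ (AllPairs.map (λ d → d ∘ nonempty-out⁻) dis) ,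
    trans (cong ((inside Vec.∷ p) ∪ˢ_) (⋃-out π)) (cong (inside Vec.∷_) cover)

  IsPartition-inn⁺ : ∀ {k} p π → IsPartition n (suc k) (p ∷ π) ⊎ (Empty p × IsPartition n k π) →
                      IsPartition (suc n) (suc k) ((inside Vec.∷ p) ∷ out π)
  IsPartition-inn⁺ p π (inj₁ (len , _ ∷ ne , dis₀ ∷ dis , cover)) =
    IsPartition-addZero p π (suc-injective len) ne dis₀ dis cover
  IsPartition-inn⁺ p π (inj₂ (p≡∅ , len , ne , dis , cover)) =
    IsPartition-addZero p π len ne
      (All.tabulate λ {q} _ (i , i∈) → p≡∅ (i , proj₁ (x∈p∩q⁻ p q i∈))) dis
      (trans (trans (cong (_∪ˢ ⋃ π) (Empty-unique p≡∅)) (∪-identityˡ (⋃ π))) cover)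

-- The recurrence for Stirling numbers of the second kind

weight : ∀ n k → List (Subset n) → ℕ
weight n k π = ⟦ isPartition? n k π ⟧

stirling₂≡Σ⊆ : ∀ n k → stirling₂ n k ≡ Σ⊆ (allSubsets n) (weight n k)
stirling₂≡Σ⊆ n k = trans (length-filter≡sum (isPartition? n k) (sublists (allSubsets n)))
                         (sum-sublists (weight n k) (allSubsets n))

weight-↭ : ∀ n k {π ρ} → π ↭ ρ → weight n k π ≡ weight n k ρ
weight-↭ n k {π} {ρ} r =
  ⟦⟧-cong (IsPartition-↭ r) (IsPartition-↭ (↭-sym r)) (isPartition? n k π) (isPartition? n k ρ)

-- The empty set is what remains of the block {0}; being unique, it gives `stirling₂ n k` the
-- coefficient 1 in the recurrence.
count-empty : ∀ n → sum (map (λ p → ⟦ ¬? (nonempty? p) ⟧) (allSubsets n)) ≡ 1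
count-empty zero    = refl
count-empty (suc n)
  rewrite map-++ (λ p → ⟦ ¬? (nonempty? p) ⟧) (out (allSubsets n)) (inn (allSubsets n))
        | sum-++ (map (λ p → ⟦ ¬? (nonempty? p) ⟧) (out (allSubsets n)))
                 (map (λ p → ⟦ ¬? (nonempty? p) ⟧) (inn (allSubsets n)))
        = cong₂ _+_ (trans (outs (allSubsets n)) (count-empty n)) (inns (allSubsets n))
  where
  outs : ∀ xs → sum (map (λ p → ⟦ ¬? (nonempty? p) ⟧) (out xs)) ≡ sum (map (λ p → ⟦ ¬? (nonempty? p) ⟧) xs)
  outs []       = refl
  outs (p ∷ xs) = cong₂ _+_
    (⟦⟧-cong (_∘ nonempty-out⁺) (_∘ nonempty-out⁻) (¬? (nonempty? (outside Vec.∷ p))) (¬? (nonempty? p)))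
    (outs xs)

  inns : ∀ xs → sum (map (λ p → ⟦ ¬? (nonempty? p) ⟧) (inn xs)) ≡ 0
  inns []       = refl
  inns (p ∷ xs) = cong₂ _+_ (⟦⟧-no (λ ¬ne → ¬ne nonempty-inn) (¬? (nonempty? (inside Vec.∷ p)))) (inns xs)

-- A sublist of `allSubsets (suc n)` is a choice `out a` of blocks avoiding 0 followed by a choice
-- of blocks containing 0, of which exactly one is allowed. Its remainder p after deletion of 0 is
-- either a block completing `a` to a partition into k + 1 blocks, or empty.
stirling₂-suc-suc : ∀ n k → stirling₂ (suc n) (suc k) ≡ stirling₂ n k + suc k * stirling₂ n (suc k)
stirling₂-suc-suc n k = begin
  stirling₂ (suc n) (suc k)
    ≡⟨ stirling₂≡Σ⊆ (suc n) (suc k) ⟩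
  Σ⊆ (out L ++ inn L) w
    ≡⟨ Σ⊆-++ w (out L) (inn L) ⟩
  Σ⊆ (out L) (λ a → Σ⊆ (inn L) (λ b → w (a ++ b)))
    ≡⟨ Σ⊆-map _ _ L ⟩
  Σ⊆ L (λ a → Σ⊆ (inn L) (λ b → w (out a ++ b)))
    ≡⟨ Σ⊆-cong blockOfZero L ⟩
  Σ⊆ L (λ a → sum (map (λ p → v (p ∷ a) + ε p * u a) L))
    ≡⟨ Σ⊆-sum _ L L ⟩
  sum (map (λ p → Σ⊆ L (λ a → v (p ∷ a) + ε p * u a)) L)
    ≡⟨ cong sum (map-cong (λ p → trans (Σ⊆-+ _ _ L) (cong (Σ⊆ L (v ∘ (p ∷_)) ℕ.+_)
         (trans (Σ⊆-cong (λ a → *-comm (ε p) (u a)) L) (trans (Σ⊆-*ʳ u (ε p) L) (*-comm (Σ⊆ L u) (ε p)))))) L) ⟩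
  sum (map (λ p → Σ⊆ L (v ∘ (p ∷_)) + ε p * Σ⊆ L u) L)
    ≡⟨ sum-map-+ _ _ L ⟩
  sum (map (λ p → Σ⊆ L (v ∘ (p ∷_))) L) + sum (map (λ p → ε p * Σ⊆ L u) L)
    -- The first sum marks the block that receives 0, so each partition is counted once per block.
    -- In the second only the empty p contributes.
    ≡⟨ cong₂ _+_ (Σ⊆-marked v (weight-↭ n (suc k)) (λ p a → ⟦⟧-no (¬IsPartition-dup p a) (isPartition? n (suc k) _)) L)
                 (trans (sum-map-*ʳ ε (Σ⊆ L u) L) (cong (_* Σ⊆ L u) (count-empty n))) ⟩
  Σ⊆ L (λ a → v a * length a) + 1 * Σ⊆ L u
    ≡⟨ cong (_+ 1 * Σ⊆ L u) (trans (Σ⊆-cong blocks L) (Σ⊆-*ʳ v (suc k) L)) ⟩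
  Σ⊆ L v * suc k + 1 * Σ⊆ L u
    ≡⟨ rearrange (Σ⊆ L v) (Σ⊆ L u) k ⟩
  Σ⊆ L u + suc k * Σ⊆ L v
    ≡⟨ cong₂ (λ x y → x + suc k * y) (stirling₂≡Σ⊆ n k) (stirling₂≡Σ⊆ n (suc k)) ⟨
  stirling₂ n k + suc k * stirling₂ n (suc k) ∎
  where
  open ≡-Reasoning
  L = allSubsets n
  w = weight (suc n) (suc k)
  v = weight n (suc k)
  u = weight n k

  ε : Subset n → ℕ
  ε p = ⟦ ¬? (nonempty? p) ⟧

  split : ∀ p a → w (out a ++ (inside Vec.∷ p) ∷ []) ≡ v (p ∷ a) + ε p * u a
  split p a = begin
    w (out a ++ (inside Vec.∷ p) ∷ []) ≡⟨ weight-↭ (suc n) (suc k) {_} {(inside Vec.∷ p) ∷ out a} (++-comm (out a) _) ⟩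
    w ((inside Vec.∷ p) ∷ out a)
      ≡⟨ ⟦⟧-cong (IsPartition-inn⁻ p a) (IsPartition-inn⁺ p a) (isPartition? (suc n) (suc k) _)
           (isPartition? n (suc k) (p ∷ a) ⊎-dec (¬? (nonempty? p) ×-dec isPartition? n k a)) ⟩
    ⟦ isPartition? n (suc k) (p ∷ a) ⊎-dec (¬? (nonempty? p) ×-dec isPartition? n k a) ⟧
      ≡⟨ ⟦⟧-⊎ (λ { ((_ , p≢∅ ∷ _ , _) , p≡∅ , _) → p≡∅ p≢∅ }) (isPartition? n (suc k) (p ∷ a))
           (¬? (nonempty? p) ×-dec isPartition? n k a) ⟩
    v (p ∷ a) + ⟦ ¬? (nonempty? p) ×-dec isPartition? n k a ⟧
      ≡⟨ cong (v (p ∷ a) ℕ.+_) (⟦⟧-× (¬? (nonempty? p)) (isPartition? n k a)) ⟩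
    v (p ∷ a) + ε p * u a ∎

  blockOfZero : ∀ a → Σ⊆ (inn L) (λ b → w (out a ++ b)) ≡ sum (map (λ p → v (p ∷ a) + ε p * u a) L)
  blockOfZero a = begin
    Σ⊆ (inn L) (λ b → w (out a ++ b)) ≡⟨ Σ⊆-map _ _ L ⟩
    Σ⊆ L (λ b → w (out a ++ inn b))
      ≡⟨ Σ⊆-singletons
           (trans (weight-↭ (suc n) (suc k) {_} {out a} (++-comm (out a) []))
                  (⟦⟧-no (¬IsPartition-out a) (isPartition? (suc n) (suc k) (out a))))
           (λ p q b → trans (weight-↭ (suc n) (suc k) {_} {inn (p ∷ q ∷ b) ++ out a} (++-comm (out a) (inn (p ∷ q ∷ b))))
                            (⟦⟧-no (¬IsPartition-inn² p q (inn b ++ out a))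
                                  (isPartition? (suc n) (suc k) (inn (p ∷ q ∷ b) ++ out a)))) L ⟩
    sum (map (λ p → w (out a ++ (inside Vec.∷ p) ∷ [])) L) ≡⟨ cong sum (map-cong (λ p → split p a) L) ⟩
    sum (map (λ p → v (p ∷ a) + ε p * u a) L) ∎

  blocks : ∀ a → v a * length a ≡ v a * suc k
  blocks a = ⟦⟧-*-cong proj₁ (isPartition? n (suc k) a)

  rearrange : ∀ x y k → x * suc k + 1 * y ≡ y + suc k * x
  rearrange = solve-∀

-- Boundary values and the sequences of the theorem

stirling₂-suc-zero : ∀ n → stirling₂ (suc n) 0 ≡ 0
stirling₂-suc-zero n = trans (stirling₂≡Σ⊆ (suc n) 0) (Σ⊆-zero none (allSubsets (suc n)))
  where
  none : ∀ π → weight (suc n) 0 π ≡ 0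
  none π = ⟦⟧-no (λ { (len , _ , _ , cover) → noBlock π len cover }) (isPartition? (suc n) 0 π)
    where
    noBlock : ∀ π → length π ≡ 0 → ⋃ π ≢ ⊤
    noBlock [] _ ()

stirling₂-zero-suc : ∀ k → stirling₂ 0 (suc k) ≡ 0
stirling₂-zero-suc zero    = refl
stirling₂-zero-suc (suc k) = refl

stirling₂-> : ∀ n j → stirling₂ n (suc (n + j)) ≡ 0
stirling₂-> zero    j = stirling₂-zero-suc j
stirling₂-> (suc n) j = begin
  stirling₂ (suc n) (suc (suc n + j)) ≡⟨ stirling₂-suc-suc n (suc n + j) ⟩
  stirling₂ n (suc (n + j)) + (2 + n + j) * stirling₂ n (suc (suc n + j))
    ≡⟨ cong₂ (λ x y → x + (2 + n + j) * y) (stirling₂-> n j)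
         (trans (cong (λ m → stirling₂ n (suc m)) (sym (+-suc n j))) (stirling₂-> n (suc j))) ⟩
  (2 + n + j) * 0 ≡⟨ *-zeroʳ (2 + n + j) ⟩
  0 ∎
  where open ≡-Reasoning

stirling₂-1 : ∀ n → stirling₂ (suc n) 1 ≡ 1
stirling₂-1 zero    = refl
stirling₂-1 (suc n) = trans (stirling₂-suc-suc (suc n) 0)
  (cong₂ (λ x y → x + 1 * y) (stirling₂-suc-zero n) (stirling₂-1 n))

-- The index K is k − 1.
diagonal : ℕ → ℕ → ℕ
diagonal K n = stirling₂ (n + K) (suc K)

S⁽²⁾≡diagonal : ∀ K n → S⁽²⁾ (suc K) n ≡ + diagonal K n
S⁽²⁾≡diagonal K n = cong (λ m → + stirling₂ (m ∸ 1) (suc K)) (+-suc n K)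

diagonal-zero : ∀ n → diagonal 0 (suc n) ≡ 1
diagonal-zero n = trans (cong (λ m → stirling₂ (suc m) 1) (+-identityʳ n)) (stirling₂-1 n)

diagonal-0 : ∀ K → diagonal K 0 ≡ 0
diagonal-0 K = trans (cong (λ m → stirling₂ K (suc m)) (sym (+-identityʳ K))) (stirling₂-> K 0)

diagonal-suc-suc : ∀ K n → diagonal (suc K) (suc n) ≡ diagonal K (suc n) + (2 + K) * diagonal (suc K) n
diagonal-suc-suc K n = trans (stirling₂-suc-suc (n + suc K) (suc K))
  (cong (λ m → stirling₂ m (suc K) + (2 + K) * diagonal (suc K) n) (+-suc n K))

-- The factor k = K + 2 of the recurrence is at least 2.
diagonal-doubles : ∀ K n → 2 * diagonal (suc K) n ≤ diagonal (suc K) (suc n)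
diagonal-doubles K n = begin
  2 * diagonal (suc K) n                             ≤⟨ *-monoˡ-≤ (diagonal (suc K) n) (m≤m+n 2 K) ⟩
  (2 + K) * diagonal (suc K) n                       ≤⟨ m≤n+m _ (diagonal K (suc n)) ⟩
  diagonal K (suc n) + (2 + K) * diagonal (suc K) n  ≡⟨ diagonal-suc-suc K n ⟨
  diagonal (suc K) (suc n)                           ∎
  where open ≤-Reasoning

-- Parity

-- The parity of the binomial coefficient (s + n) C s.
pascal : ℕ → ℕ → Parity
pascal zero    n       = 1ℙ
pascal (suc s) zero    = 1ℙ
pascal (suc s) (suc n) = pascal s (suc n) ℙ.+ pascal (suc s) n

pascal-0 : ∀ s → pascal s 0 ≡ 1ℙ
pascal-0 zero    = refl
pascal-0 (suc s) = refl

-- Two visible successors per step let `pascal` and `parity` compute on it.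
double : ℕ → ℕ
double zero    = zero
double (suc n) = suc (suc (double n))

double≡2* : ∀ n → double n ≡ 2 * n
double≡2* zero    = refl
double≡2* (suc n) = trans (cong (2 ℕ.+_) (double≡2* n)) (sym (*-suc 2 n))

parity-double : ∀ n → parity (double n) ≡ 0ℙ
parity-double zero    = refl
parity-double (suc n) = parity-double n

pascal-even-even : ∀ s n → pascal (double s) (double n) ≡ pascal s n
pascal-even-odd  : ∀ s n → pascal (double s) (suc (double n)) ≡ pascal s n
pascal-odd-even  : ∀ s n → pascal (suc (double s)) (double n) ≡ pascal s n
pascal-odd-odd   : ∀ s n → pascal (suc (double s)) (suc (double n)) ≡ 0ℙ
pascal-even-even zero    n       = refl
pascal-even-even (suc s) zero    = refl
pascal-even-even (suc s) (suc n) = cong₂ ℙ._+_ (pascal-odd-even s (suc n)) (pascal-even-odd (suc s) n)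
pascal-even-odd zero    n = refl
pascal-even-odd (suc s) n = cong₂ ℙ._+_ (pascal-odd-odd s n) (pascal-even-even (suc s) n)
pascal-odd-even s zero    = sym (pascal-0 s)
pascal-odd-even s (suc n) =
  trans (cong₂ ℙ._+_ (pascal-even-even s (suc n)) (pascal-odd-odd s n)) (ℙ.+-identityʳ (pascal s (suc n)))
pascal-odd-odd s n =
  trans (cong₂ ℙ._+_ (pascal-even-odd s n) (pascal-odd-even s n)) (ℙ.p+p≡0ℙ (pascal s n))

-- Modulo 2 the factor k of the recurrence alternates. Passing to an even k copies the parities;
-- passing to an odd k takes partial sums, which is Pascal's rule. Hence s grows by one with every
-- two steps in K.
parity-diagonal-even : ∀ s n → parity (diagonal (double s) (suc n)) ≡ pascal s n
parity-diagonal-odd  : ∀ s n → parity (diagonal (suc (double s)) (suc n)) ≡ pascal s n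
parity-diagonal-even zero    n = cong parity (diagonal-zero n)
parity-diagonal-even (suc s) n = begin
  parity (diagonal (double (suc s)) (suc n))
    ≡⟨ cong parity (diagonal-suc-suc (suc (double s)) n) ⟩
  parity (diagonal (suc (double s)) (suc n) + (3 + double s) * diagonal (double (suc s)) n)
    ≡⟨ ℙ.+-homo-+ (diagonal (suc (double s)) (suc n)) _ ⟩
  parity (diagonal (suc (double s)) (suc n)) ℙ.+ parity ((3 + double s) * diagonal (double (suc s)) n)
    ≡⟨ cong₂ ℙ._+_ (parity-diagonal-odd s n) (trans (ℙ.*-homo-* (3 + double s) (diagonal (double (suc s)) n))
         (cong (ℙ._* parity (diagonal (double (suc s)) n)) parity-odd)) ⟩
  pascal s n ℙ.+ parity (diagonal (double (suc s)) n)
    ≡⟨ last n ⟩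
  pascal (suc s) n ∎
  where
  open ≡-Reasoning
  parity-odd : parity (suc (double s)) ≡ 1ℙ
  parity-odd = trans (sym (ℙ.suc-homo-⁻¹ (suc (double s)))) (cong ℙ._⁻¹ (parity-double s))

  last : ∀ n → pascal s n ℙ.+ parity (diagonal (double (suc s)) n) ≡ pascal (suc s) n
  last zero    = cong₂ ℙ._+_ (pascal-0 s) (cong parity (diagonal-0 (double (suc s))))
  last (suc n) = cong (pascal s (suc n) ℙ.+_) (parity-diagonal-even (suc s) n)
parity-diagonal-odd s n = begin
  parity (diagonal (suc (double s)) (suc n))
    ≡⟨ cong parity (diagonal-suc-suc (double s) n) ⟩
  parity (diagonal (double s) (suc n) + (2 + double s) * diagonal (suc (double s)) n)
    ≡⟨ ℙ.+-homo-+ (diagonal (double s) (suc n)) _ ⟩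
  parity (diagonal (double s) (suc n)) ℙ.+ parity ((2 + double s) * diagonal (suc (double s)) n)
    ≡⟨ cong₂ ℙ._+_ (parity-diagonal-even s n) (trans (ℙ.*-homo-* (2 + double s) (diagonal (suc (double s)) n))
         (cong (ℙ._* parity (diagonal (suc (double s)) n)) (parity-double s))) ⟩
  pascal s n ℙ.+ 0ℙ
    ≡⟨ ℙ.+-identityʳ (pascal s n) ⟩
  pascal s n ∎
  where open ≡-Reasoning

halve : ∀ n → ∃[ h ] (n ≡ double h ⊎ n ≡ suc (double h))
halve zero = 0 , inj₁ refl
halve (suc n) with halve n
... | h , inj₁ refl = h , inj₂ refl
... | h , inj₂ refl = suc h , inj₁ refl

n≤double : ∀ n → n ≤ double n
n≤double zero    = z≤n
n≤double (suc n) = s≤s (m≤n⇒m≤1+n (n≤double n))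

ones : ℕ → ℕ
ones zero    = 0
ones (suc e) = suc (double (ones e))

suc-ones : ∀ e → suc (ones e) ≡ 2 ^ e
suc-ones zero    = refl
suc-ones (suc e) = trans (double≡2* (suc (ones e))) (cong (2 *_) (suc-ones e))

-- If 2 ^ e is the exact power of 2 dividing s, adding s to 2 ^ e − 1 produces
-- no carry, whereas adding it to 2 ^ (e + 1) − 1 does.
pascal-jump : ∀ s → 0 < s → ∃[ e ] pascal s (ones e) ≢ pascal s (ones (suc e))
pascal-jump = <-rec _ go
  where
  go : ∀ s → (∀ {t} → t < s → 0 < t → ∃[ e ] pascal t (ones e) ≢ pascal t (ones (suc e))) →
       0 < s → ∃[ e ] pascal s (ones e) ≢ pascal s (ones (suc e))
  go s rec 0<s with halve s
  go _ rec () | zero , inj₁ refl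
  -- Doubling s appends a digit 0, which moves the jump from e to e + 1.
  go _ rec 0<s | suc h , inj₁ refl with rec {suc h} (s≤s (s≤s (n≤double h))) (s≤s z≤n)
  ... | e , jump = suc e , λ eq → jump
    (trans (sym (pascal-even-odd (suc h) (ones e))) (trans eq (pascal-even-odd (suc h) (ones (suc e)))))
  go _ rec 0<s | h , inj₂ refl = 0 , λ eq → case (trans eq (pascal-odd-odd h 0))
    where
    case : 1ℙ ≢ 0ℙ
    case ()

-- The condition 2 ≤ K makes s = ⌊K / 2⌋ positive. The shift by one in `parity-diagonal-even` and
-- `parity-diagonal-odd` turns the arguments 2ᵉ - 1 into powers of 2.
parity-jump : ∀ K → 2 ≤ K → ∃[ e ] parity (diagonal K (2 ^ e)) ≢ parity (diagonal K (2 ^ suc e))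
parity-jump K 2≤K with halve K
parity-jump _ ()         | zero , inj₁ refl
parity-jump _ (s≤s ())   | zero , inj₂ refl
parity-jump _ _ | suc h , inj₁ refl with pascal-jump (suc h) (s≤s z≤n)
... | e , jump = e , λ eq → jump (trans (sym (at e)) (trans eq (at (suc e))))
  where
  at : ∀ e → parity (diagonal (double (suc h)) (2 ^ e)) ≡ pascal (suc h) (ones e)
  at e = trans (cong (λ n → parity (diagonal (double (suc h)) n)) (sym (suc-ones e)))
               (parity-diagonal-even (suc h) (ones e))
parity-jump _ _ | suc h , inj₂ refl with pascal-jump (suc h) (s≤s z≤n)
... | e , jump = e , λ eq → jump (trans (sym (at e)) (trans eq (at (suc e))))
  where
  at : ∀ e → parity (diagonal (suc (double (suc h))) (2 ^ e)) ≡ pascal (suc h) (ones e)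
  at e = trans (cong (λ n → parity (diagonal (suc (double (suc h))) n)) (sym (suc-ones e)))
               (parity-diagonal-odd (suc h) (ones e))

-- Finite differences

Δ : ℕ → (ℕ → ℤ) → ℕ → ℤ
Δ zero    f x = f x
Δ (suc K) f x = Δ K f (suc x) ℤ.- Δ K f x

Δ-cong : ∀ K {f g : ℕ → ℤ} → (∀ x → f x ≡ g x) → ∀ x → Δ K f x ≡ Δ K g x
Δ-cong zero    f≡g x = f≡g x
Δ-cong (suc K) f≡g x = cong₂ ℤ._-_ (Δ-cong K f≡g (suc x)) (Δ-cong K f≡g x)

-- Only the first difference of the factor y survives, so Leibniz leaves x Δᴷ⁺¹g(x) + (K + 1) Δᴷg(x
-- + 1). Writing Δᴷg(x + 1) as Δᴷ⁺¹g(x) + Δᴷg(x) brings everything to the point x.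
Δ-leibniz : ∀ K (g : ℕ → ℤ) x →
  Δ (suc K) (λ y → + y ℤ.* g y) x ≡ (+ x ℤ.+ + suc K) ℤ.* Δ (suc K) g x ℤ.+ + suc K ℤ.* Δ K g x
Δ-leibniz zero    g x = base (+ x) (g (suc x)) (g x)
  where
  base : ∀ x a b → (+ 1 ℤ.+ x) ℤ.* a ℤ.- x ℤ.* b ≡ (x ℤ.+ + 1) ℤ.* (a ℤ.- b) ℤ.+ + 1 ℤ.* b
  base = ℤ-Solver.solve-∀
Δ-leibniz (suc K) g x =
  trans (cong₂ ℤ._-_ (Δ-leibniz K g (suc x)) (Δ-leibniz K g x))
        (step (+ x) (+ suc K) (Δ K g (suc (suc x))) (Δ K g (suc x)) (Δ K g x))
  where
  step : ∀ x k a b c →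
    ((+ 1 ℤ.+ x ℤ.+ k) ℤ.* (a ℤ.- b) ℤ.+ k ℤ.* b) ℤ.- ((x ℤ.+ k) ℤ.* (b ℤ.- c) ℤ.+ k ℤ.* c)
    ≡ (x ℤ.+ (+ 1 ℤ.+ k)) ℤ.* (a ℤ.- b ℤ.- (b ℤ.- c)) ℤ.+ (+ 1 ℤ.+ k) ℤ.* (b ℤ.- c)
  step = ℤ-Solver.solve-∀

Δ-one : ∀ K x → Δ (suc K) (λ _ → 1ℤ) x ≡ 0ℤ
Δ-one zero    x = refl
Δ-one (suc K) x = cong₂ ℤ._-_ (Δ-one K (suc x)) (Δ-one K x)

-- At x = 1 the coefficients of `Δ-leibniz` are K + 2 and K + 1, which are those of the Stirling
-- recurrence after multiplication by (K + 1)!.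
!*stirling₂ : ∀ K N → + (K !) ℤ.* + stirling₂ (suc N) (suc K) ≡ Δ K (λ x → (+ x) ℤ.^ N) 1
!*stirling₂ zero N = trans (cong (λ m → + 1 ℤ.* + m) (stirling₂-1 N)) (sym (ℤ.^-zeroˡ N))
!*stirling₂ (suc K) zero = begin
  + (suc K !) ℤ.* + stirling₂ 1 (suc (suc K)) ≡⟨ cong (λ m → + (suc K !) ℤ.* + m) (stirling₂-> 1 K) ⟩
  + (suc K !) ℤ.* 0ℤ                          ≡⟨ ℤ.*-zeroʳ (+ (suc K !)) ⟩
  0ℤ                                          ≡⟨ Δ-one K 1 ⟨
  Δ (suc K) (λ x → (+ x) ℤ.^ 0) 1               ∎
  where open ≡-Reasoning
!*stirling₂ (suc K) (suc N) = begin
  + (suc K !) ℤ.* + stirling₂ (suc (suc N)) (suc (suc K))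
    ≡⟨ cong (λ m → + (suc K !) ℤ.* + m) (stirling₂-suc-suc (suc N) (suc K)) ⟩
  + (suc K !) ℤ.* + (a + suc (suc K) * b)
    ≡⟨ cong₂ ℤ._*_ (ℤ.pos-* (suc K) (K !)) (cong (ℤ._+_ (+ a)) (ℤ.pos-* (suc (suc K)) b)) ⟩
  (+ suc K ℤ.* + (K !)) ℤ.* (+ a ℤ.+ + suc (suc K) ℤ.* + b)
    ≡⟨ rearrange (+ suc K) (+ (K !)) (+ a) (+ b) ⟩
  (+ 1 ℤ.+ + suc K) ℤ.* ((+ suc K ℤ.* + (K !)) ℤ.* + b) ℤ.+ + suc K ℤ.* (+ (K !) ℤ.* + a)
    ≡⟨ cong₂ (λ x y → (+ 1 ℤ.+ + suc K) ℤ.* x ℤ.+ + suc K ℤ.* y)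
         (trans (cong (ℤ._* + b) (sym (ℤ.pos-* (suc K) (K !)))) (!*stirling₂ (suc K) N)) (!*stirling₂ K N) ⟩
  (+ 1 ℤ.+ + suc K) ℤ.* Δ (suc K) (λ x → (+ x) ℤ.^ N) 1 ℤ.+ + suc K ℤ.* Δ K (λ x → (+ x) ℤ.^ N) 1
    ≡⟨ Δ-leibniz K (λ x → (+ x) ℤ.^ N) 1 ⟨
  Δ (suc K) (λ x → (+ x) ℤ.^ suc N) 1 ∎
  where
  open ≡-Reasoning
  a = stirling₂ (suc N) (suc K)
  b = stirling₂ (suc N) (suc (suc K))

  rearrange : ∀ k f a b → (k ℤ.* f) ℤ.* (a ℤ.+ (+ 1 ℤ.+ k) ℤ.* b)
                        ≡ (+ 1 ℤ.+ k) ℤ.* ((k ℤ.* f) ℤ.* b) ℤ.+ k ℤ.* (f ℤ.* a)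
  rearrange = ℤ-Solver.solve-∀

-- Divisor lists obtained by different routes agree as sets but not in order; without repetitions
-- this suffices for comparing lengths and sums.
unique-↭ : {xs ys : List A} → Unique xs → Unique ys →
           (∀ {x} → x ∈ xs → x ∈ ys) → (∀ {x} → x ∈ ys → x ∈ xs) → xs ↭ ys
unique-↭ uxs uys to from = ∼bag⇒↭ (unique∧set⇒bag uxs uys (mk⇔ to from))

-- Divisibility by primes

^∣*⇒^∣ : ∀ {p m n} → Prime p → p ∤ m → ∀ v → p ^ v ∣ m * n → p ^ v ∣ n
^∣*⇒^∣ pp p∤m zero    _ = 1∣ _
^∣*⇒^∣ {p} {m} {n} pp p∤m (suc v) pᵛ⁺¹∣mn with euclidsLemma m n pp (∣-trans (m∣m*n (p ^ v)) pᵛ⁺¹∣mn)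
... | inj₁ p∣m = contradiction p∣m p∤m
... | inj₂ (divides q refl) = subst (p * p ^ v ∣_) (*-comm p q)
  (*-monoʳ-∣ p (^∣*⇒^∣ pp p∤m v (*-cancelˡ-∣ p {{prime⇒nonZero pp}}
    (subst (p * p ^ v ∣_) (trans (cong (m ℕ.*_) (*-comm q p)) (*-x∙yz≈y∙xz m p q)) pᵛ⁺¹∣mn))))

prime>1 : ∀ {p} → Prime p → 1 < p
prime>1 pp = nonTrivial⇒n>1 _ {{prime⇒nonTrivial pp}}

primeDivisor : ∀ n → 1 < n → ∃[ p ] (Prime p × p ∣ n)
primeDivisor n@(suc _) 1<n = go (factors f) (isFactorisation f) (factorsPrime f)
  where
  open PrimeFactorisation
  f = factorise n

  go : ∀ ps → n ≡ product ps → All Prime ps → ∃[ p ] (Prime p × p ∣ n)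
  go []       n≡1 _         = contradiction (subst (1 <_) n≡1 1<n) (λ { (s≤s ()) })
  go (p ∷ ps) n≡  (pp ∷ _) = p , pp , subst (p ∣_) (sym n≡) (m∣m*n (product ps))

strip : ∀ {p} → Prime p → ∀ n → 0 < n → ∃[ v ] ∃[ m ] (0 < m × n ≡ p ^ v * m × p ∤ m)
strip {p} pp = <-rec _ go
  where
  go : ∀ n → (∀ {m} → m < n → 0 < m → ∃[ v ] ∃[ o ] (0 < o × m ≡ p ^ v * o × p ∤ o)) →
       0 < n → ∃[ v ] ∃[ m ] (0 < m × n ≡ p ^ v * m × p ∤ m)
  go n rec 0<n with p ∣? n
  ... | no p∤n = 0 , n , 0<n , sym (*-identityˡ n) , p∤n
  go .(zero * p) rec () | yes (divides zero refl)
  go .(suc q * p) rec 0<n | yes (divides (suc q) refl)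
    with rec {suc q} (m<m*n (suc q) p (prime>1 pp)) (s≤s z≤n)
  ... | v , m , 0<m , eq , p∤m =
    suc v , m , 0<m , trans (*-comm (suc q) p) (trans (cong (p *_) eq) (sym (*-assoc p (p ^ v) m))) , p∤m

^-strip-∣ : ∀ {p} → Prime p → ∀ v m {x} → p ∤ m → p ^ v ∣ x → m ∣ x → p ^ v * m ∣ x
^-strip-∣ {p} pp v m p∤m pᵛ∣x (divides q refl) =
  *-monoˡ-∣ m (^∣*⇒^∣ pp p∤m v (subst (p ^ v ∣_) (*-comm q m) pᵛ∣x))

-- Strip from n the full power of one prime: that power divides x by hypothesis, the smaller
-- cofactor by induction, and the two are coprime.
primePowers-∣ : ∀ x n → 0 < n → (∀ p e → Prime p → p ^ e ∣ n → p ^ e ∣ x) → n ∣ x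
primePowers-∣ x = <-rec _ go
  where
  go : ∀ n → (∀ {m} → m < n → 0 < m → (∀ p e → Prime p → p ^ e ∣ m → p ^ e ∣ x) → m ∣ x) →
       0 < n → (∀ p e → Prime p → p ^ e ∣ n → p ^ e ∣ x) → n ∣ x
  go n rec 0<n h with m≤n⇒m<n∨m≡n 0<n
  ... | inj₂ refl = 1∣ x
  ... | inj₁ 1<n with primeDivisor n 1<n
  ...   | p , pp , p∣n with strip pp n 0<n
  ...     | zero , m , 0<m , refl , p∤m = contradiction (subst (p ∣_) (+-identityʳ m) p∣n) p∤m
  ...     | suc v , m , 0<m , refl , p∤m =
    ^-strip-∣ pp (suc v) m p∤m (h p (suc v) pp (m∣m*n m))
      (rec m<n 0<m λ q e qp qᵉ∣m → h q e qp (∣-trans qᵉ∣m (n∣m*n (p ^ suc v))))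
    where
    instance
      m≢0 : NonZero m
      m≢0 = >-nonZero 0<m

    m<n : m < p ^ suc v * m
    m<n = subst (m <_) (*-comm m (p ^ suc v)) (m<m*n m (p ^ suc v) (begin-strict
      1         <⟨ prime>1 pp ⟩
      p         ≡⟨ *-identityʳ p ⟨
      p * 1     ≤⟨ *-monoʳ-≤ p (m^n>0 p {{prime⇒nonZero pp}} v) ⟩
      p * p ^ v ∎))
      where open ≤-Reasoning

-- The Möbius function

isPrimeDivisor? : ∀ n → Decidable (λ p → Prime p × p ∣ n)
isPrimeDivisor? n p = prime? p ×-dec p ∣? n

∈-primeDivisors⁺ : ∀ {n p} .{{_ : NonZero n}} → Prime p → p ∣ n → p ∈ primeDivisors n
∈-primeDivisors⁺ {n} pp p∣n = ∈-filter⁺ (isPrimeDivisor? n) (∈-upTo⁺ (s≤s (∣⇒≤ p∣n))) (pp , p∣n)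

∈-primeDivisors⁻ : ∀ {n p} → p ∈ primeDivisors n → Prime p × p ∣ n
∈-primeDivisors⁻ {n} = proj₂ ∘ ∈-filter⁻ (isPrimeDivisor? n) {xs = upTo (suc n)}

primeDivisors-unique : ∀ n → Unique (primeDivisors n)
primeDivisors-unique n = Unique.filter⁺ (isPrimeDivisor? n) (Unique.upTo⁺ (suc n))

HasSquare : ℕ → Set
HasSquare n = Any.Any (λ p → p * p ∣ n) (primeDivisors n)

hasSquare? : ∀ n → Dec (HasSquare n)
hasSquare? n = Any.any? (λ p → p * p ∣? n) (primeDivisors n)

μ-square : ∀ {p n} .{{_ : NonZero n}} → Prime p → p * p ∣ n → μ n ≡ 0ℤ
μ-square {p} {n} pp pp∣n
  rewrite dec-true (hasSquare? n) (lose (∈-primeDivisors⁺ pp (∣-trans (m∣m*n p) pp∣n)) pp∣n) = refl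

μ-cases : ∀ n → μ n ≡ 0ℤ ⊎ μ n ≡ 1ℤ ⊎ μ n ≡ -1ℤ
μ-cases n with does (hasSquare? n)
... | true  = inj₁ refl
... | false = inj₂ (powers (length (primeDivisors n)))
  where
  powers : ∀ m → -1ℤ ℤ.^ m ≡ 1ℤ ⊎ -1ℤ ℤ.^ m ≡ -1ℤ
  powers zero = inj₁ refl
  powers (suc m) with powers m
  ... | inj₁ eq = inj₂ (cong (-1ℤ ℤ.*_) eq)
  ... | inj₂ eq = inj₁ (cong (-1ℤ ℤ.*_) eq)

module _ {p : ℕ} (pp : Prime p) where

  private instance
    p≢0 : NonZero p
    p≢0 = prime⇒nonZero pp

  ∤-prime : ∀ {q} → Prime q → p ≢ q → q ∤ p
  ∤-prime qp p≢q q∣p with prime⇒irreducible pp q∣p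
  ... | inj₁ refl = contradiction qp ¬prime[1]
  ... | inj₂ q≡p  = p≢q (sym q≡p)

  primeDivisors-* : ∀ {n} .{{_ : NonZero n}} → p ∤ n → primeDivisors (p * n) ↭ p ∷ primeDivisors n
  primeDivisors-* {n} p∤n = unique-↭ (primeDivisors-unique (p * n))
    (All.tabulate (λ { q∈ refl → p∤n (proj₂ (∈-primeDivisors⁻ {n} q∈)) }) ∷ primeDivisors-unique n)
    to from
    where
    to : ∀ {q} → q ∈ primeDivisors (p * n) → q ∈ p ∷ primeDivisors n
    to {q} q∈ with ∈-primeDivisors⁻ {p * n} q∈
    ... | qp , q∣pn with p ≟ q
    ...   | yes refl = here refl
    ...   | no p≢q with euclidsLemma p n qp q∣pn
    ...     | inj₁ q∣p = contradiction q∣p (∤-prime qp p≢q)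
    ...     | inj₂ q∣n = there (∈-primeDivisors⁺ qp q∣n)

    from : ∀ {q} → q ∈ p ∷ primeDivisors n → q ∈ primeDivisors (p * n)
    from (here refl) = ∈-primeDivisors⁺ {{m*n≢0 p n}} pp (m∣m*n n)
    from (there q∈) with ∈-primeDivisors⁻ {n} q∈
    ... | qp , q∣n = ∈-primeDivisors⁺ {{m*n≢0 p n}} qp (∣-trans q∣n (n∣m*n p))

  hasSquare-*⁺ : ∀ {n} .{{_ : NonZero n}} → HasSquare n → HasSquare (p * n)
  hasSquare-*⁺ {n} s with find s
  ... | q , q∈ , qq∣n with ∈-primeDivisors⁻ {n} q∈
  ...   | qp , q∣n =
    lose (∈-primeDivisors⁺ {{m*n≢0 p n}} qp (∣-trans q∣n (n∣m*n p))) (∣-trans qq∣n (n∣m*n p))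

  hasSquare-*⁻ : ∀ {n} .{{_ : NonZero n}} → p ∤ n → HasSquare (p * n) → HasSquare n
  hasSquare-*⁻ {n} p∤n s with find s
  ... | q , q∈ , qq∣pn with ∈-primeDivisors⁻ {p * n} q∈
  ...   | qp , _ with p ≟ q
  ...     | yes refl = contradiction (*-cancelˡ-∣ p qq∣pn) p∤n
  ...     | no p≢q = lose (∈-primeDivisors⁺ qp (∣-trans (m∣m*n q) qq∣n)) qq∣n
    where
    qq∣n : q * q ∣ n
    qq∣n = subst (_∣ n) (cong (q *_) (*-identityʳ q)) (^∣*⇒^∣ qp (∤-prime qp p≢q) 2
             (subst (_∣ p * n) (cong (q *_) (sym (*-identityʳ q))) qq∣pn))

  -- When p is prime to n, the product p n has one more prime divisor than n and no new square
  -- divisor.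
  μ-* : ∀ {n} .{{_ : NonZero n}} → p ∤ n → μ (p * n) ≡ ℤ.- μ n
  μ-* {n} p∤n with hasSquare? n | hasSquare? (p * n)
  ... | yes s | yes _ = refl
  ... | yes s | no ¬s = contradiction (hasSquare-*⁺ s) ¬s
  ... | no ¬s | yes s = contradiction (hasSquare-*⁻ p∤n s) ¬s
  ... | no _  | no _  =
    trans (cong (-1ℤ ℤ.^_) (↭-length (primeDivisors-* p∤n))) (ℤ.-1*i≡-i (-1ℤ ℤ.^ length (primeDivisors n)))

-- Möbius transforms

Σℤ : List ℕ → (ℕ → ℤ) → ℤ
Σℤ xs f = foldr ℤ._+_ 0ℤ (map f xs)

Σℤ-cong : ∀ xs {f g : ℕ → ℤ} → (∀ {x} → x ∈ xs → f x ≡ g x) → Σℤ xs f ≡ Σℤ xs g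
Σℤ-cong []       f≡g = refl
Σℤ-cong (x ∷ xs) f≡g = cong₂ ℤ._+_ (f≡g (here refl)) (Σℤ-cong xs (f≡g ∘ there))

Σℤ-zero : ∀ xs → Σℤ xs (λ _ → 0ℤ) ≡ 0ℤ
Σℤ-zero []       = refl
Σℤ-zero (x ∷ xs) = trans (ℤ.+-identityˡ _) (Σℤ-zero xs)

Σℤ-- : ∀ xs (f g : ℕ → ℤ) → Σℤ xs (λ x → f x ℤ.- g x) ≡ Σℤ xs f ℤ.- Σℤ xs g
Σℤ-- []       f g = refl
Σℤ-- (x ∷ xs) f g = trans (cong (ℤ._+_ (f x ℤ.- g x)) (Σℤ-- xs f g)) (rearrange (f x) (g x) (Σℤ xs f) (Σℤ xs g))
  where
  rearrange : ∀ a b c d → a ℤ.- b ℤ.+ (c ℤ.- d) ≡ a ℤ.+ c ℤ.- (b ℤ.+ d)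
  rearrange = ℤ-Solver.solve-∀

Σℤ-*ˡ : ∀ c xs (f : ℕ → ℤ) → Σℤ xs (λ x → c ℤ.* f x) ≡ c ℤ.* Σℤ xs f
Σℤ-*ˡ c []       f = sym (ℤ.*-zeroʳ c)
Σℤ-*ˡ c (x ∷ xs) f = trans (cong (ℤ._+_ (c ℤ.* f x)) (Σℤ-*ˡ c xs f)) (sym (ℤ.*-distribˡ-+ c (f x) (Σℤ xs f)))

Σℤ-++ : ∀ xs ys (f : ℕ → ℤ) → Σℤ (xs ++ ys) f ≡ Σℤ xs f ℤ.+ Σℤ ys f
Σℤ-++ []       ys f = sym (ℤ.+-identityˡ _)
Σℤ-++ (x ∷ xs) ys f = trans (cong (ℤ._+_ (f x)) (Σℤ-++ xs ys f)) (sym (ℤ.+-assoc (f x) (Σℤ xs f) (Σℤ ys f)))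

Σℤ-↭ : ∀ {xs ys} → xs ↭ ys → ∀ f → Σℤ xs f ≡ Σℤ ys f
Σℤ-↭ r f = foldr-commMonoid (setoid ℤ) ℤ.+-0-isCommutativeMonoid (↭⇒↭ₛ (map⁺ f r))

divisors : ℕ → List ℕ
divisors n = map suc (filter (λ i → suc i ∣? n) (upTo n))

∈-divisors⁺ : ∀ {n d} .{{_ : NonZero n}} → d ∣ n → d ∈ divisors n
∈-divisors⁺ {n} {zero}  0∣n = contradiction (0∣⇒≡0 0∣n) (≢-nonZero⁻¹ n)
∈-divisors⁺ {n} {suc i} d∣n = ∈-map⁺ suc (∈-filter⁺ (λ i → suc i ∣? n) (∈-upTo⁺ (∣⇒≤ d∣n)) d∣n)

∈-divisors⁻ : ∀ {n d} → d ∈ divisors n → d ∣ n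
∈-divisors⁻ {n} d∈ with ∈-map⁻ suc d∈
... | i , i∈ , refl = proj₂ (∈-filter⁻ (λ i → suc i ∣? n) {xs = upTo n} i∈)

divisors-unique : ∀ n → Unique (divisors n)
divisors-unique n = Unique.map⁺ suc-injective (Unique.filter⁺ (λ i → suc i ∣? n) (Unique.upTo⁺ n))

-- The value at d = 0, which is never a divisor, is junk.
μ*-term : Sequence → ℕ → ℕ → ℤ
μ*-term A n zero    = 0ℤ
μ*-term A n (suc i) = μ (n / suc i) ℤ.* A (suc i)

μ*≡Σ : ∀ A n → μ* A n ≡ Σℤ (divisors n) (μ*-term A n)
μ*≡Σ A n = cong (foldr ℤ._+_ 0ℤ) (map-∘ (filter (λ i → suc i ∣? n) (upTo n)))

-- Writing the argument as c * d exposes the quotient inside `μ`; terms are evaluated by first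
-- rewriting n in this form.
μ*-term-* : ∀ A c d .{{_ : NonZero d}} → μ*-term A (c * d) d ≡ μ c ℤ.* A d
μ*-term-* A c (suc i) = cong (λ m → μ m ℤ.* A (suc i)) (m*n/n≡m c (suc i))

μ*-cong : ∀ {A B} n → (∀ d .{{_ : NonZero d}} → A d ≡ B d) → μ* A n ≡ μ* B n
μ*-cong n A≡B = Σℤ-cong (filter (λ i → suc i ∣? n) (upTo n))
  (λ {i} _ → cong (μ (n / suc i) ℤ.*_) (A≡B (suc i)))

μ*-- : ∀ A B n → μ* (λ d → A d ℤ.- B d) n ≡ μ* A n ℤ.- μ* B n
μ*-- A B n = trans (Σℤ-cong ds (λ {i} _ → distrib (μ (n / suc i)) (A (suc i)) (B (suc i)))) (Σℤ-- ds _ _)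
  where
  ds = filter (λ i → suc i ∣? n) (upTo n)

  distrib : ∀ a b c → a ℤ.* (b ℤ.- c) ≡ a ℤ.* b ℤ.- a ℤ.* c
  distrib = ℤ-Solver.solve-∀

μ*-*ˡ : ∀ c A n → μ* (λ d → c ℤ.* A d) n ≡ c ℤ.* μ* A n
μ*-*ˡ c A n = trans (Σℤ-cong ds (λ {i} _ → exchange (μ (n / suc i)) c (A (suc i)))) (Σℤ-*ˡ c ds _)
  where
  ds = filter (λ i → suc i ∣? n) (upTo n)

  exchange : ∀ a b c → a ℤ.* (b ℤ.* c) ≡ b ℤ.* (a ℤ.* c)
  exchange = ℤ-Solver.solve-∀

module _ {p : ℕ} (pp : Prime p) where

  private instance
    p≢0 : NonZero p
    p≢0 = prime⇒nonZero pp

  coprimeDivisors : ℕ → List ℕ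
  coprimeDivisors n = filter (λ d → ¬? (p ∣? d)) (divisors (p * n))

  ∈-coprimeDivisors⁻ : ∀ {n d} → d ∈ coprimeDivisors n → d ∣ p * n × p ∤ d
  ∈-coprimeDivisors⁻ {n} d∈ with ∈-filter⁻ (λ d → ¬? (p ∣? d)) {xs = divisors (p * n)} d∈
  ... | d∈′ , p∤d = ∈-divisors⁻ {p * n} d∈′ , p∤d

  coprimeDivisors-unique : ∀ n → Unique (coprimeDivisors n)
  coprimeDivisors-unique n = Unique.filter⁺ _ (divisors-unique (p * n))

  divisors-* : ∀ n .{{_ : NonZero n}} → divisors (p * n) ↭ map (p *_) (divisors n) ++ coprimeDivisors n
  divisors-* n = unique-↭ (divisors-unique (p * n))
    (Unique.++⁺ (Unique.map⁺ (λ {x} {y} → *-cancelˡ-≡ x y p) (divisors-unique n)) (coprimeDivisors-unique n)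
      λ { (d∈ , d∈′) → disjoint d∈ d∈′ })
    to from
    where
    instance
      pn≢0 : NonZero (p * n)
      pn≢0 = m*n≢0 p n

    disjoint : ∀ {d} → d ∈ map (p *_) (divisors n) → ¬ (d ∈ coprimeDivisors n)
    disjoint d∈ d∈′ with ∈-map⁻ (p *_) d∈
    ... | c , _ , refl = proj₂ (∈-coprimeDivisors⁻ {n} d∈′) (m∣m*n c)

    to : ∀ {d} → d ∈ divisors (p * n) → d ∈ map (p *_) (divisors n) ++ coprimeDivisors n
    to {d} d∈ with p ∣? d
    ... | no p∤d = ∈-++⁺ʳ (map (p *_) (divisors n)) (∈-filter⁺ (λ d → ¬? (p ∣? d)) d∈ p∤d)
    ... | yes (divides c refl) = ∈-++⁺ˡ (subst (_∈ map (p *_) (divisors n)) (*-comm p c)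
      (∈-map⁺ (p *_) (∈-divisors⁺ (*-cancelˡ-∣ p (subst (_∣ p * n) (*-comm c p) (∈-divisors⁻ {p * n} d∈))))))

    from : ∀ {d} → d ∈ map (p *_) (divisors n) ++ coprimeDivisors n → d ∈ divisors (p * n)
    from d∈ with ∈-++⁻ (map (p *_) (divisors n)) d∈
    ... | inj₂ d∈′ = ∈-divisors⁺ (proj₁ (∈-coprimeDivisors⁻ {n} d∈′))
    ... | inj₁ d∈′ with ∈-map⁻ (p *_) d∈′
    ...   | c , c∈ , refl = ∈-divisors⁺ (*-monoʳ-∣ p (∈-divisors⁻ {n} c∈))

  coprimeDivisors-∤ : ∀ n .{{_ : NonZero n}} → p ∤ n → coprimeDivisors n ↭ divisors n
  coprimeDivisors-∤ n p∤n = unique-↭ (coprimeDivisors-unique n) (divisors-unique n) to from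
    where
    to : ∀ {d} → d ∈ coprimeDivisors n → d ∈ divisors n
    to {d} d∈ with ∈-coprimeDivisors⁻ {n} d∈
    ... | divides c pn≡cd , p∤d with euclidsLemma c d pp (divides n (trans (sym pn≡cd) (*-comm p n)))
    ...   | inj₂ p∣d = contradiction p∣d p∤d
    ...   | inj₁ (divides b refl) = ∈-divisors⁺ (divides b (*-cancelˡ-≡ n (b * d) p
      (trans pn≡cd (trans (cong (_* d) (*-comm b p)) (*-assoc p b d)))))

    from : ∀ {d} → d ∈ divisors n → d ∈ coprimeDivisors n
    from d∈ = ∈-filter⁺ (λ d → ¬? (p ∣? d)) (∈-divisors⁺ {{m*n≢0 p n}} (∣-trans (∈-divisors⁻ {n} d∈) (n∣m*n p)))
      (λ p∣d → p∤n (∣-trans p∣d (∈-divisors⁻ {n} d∈)))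

  module _ (A : Sequence) (n : ℕ) .{{n≢0 : NonZero n}} where

    private
      instance
        pn≢0 : NonZero (p * n)
        pn≢0 = m*n≢0 p n

      ∣n⇒≢0 : ∀ {m d} .{{_ : NonZero m}} → d ∣ m → NonZero d
      ∣n⇒≢0 {m} {d} d∣m = ≢-nonZero λ { refl → ≢-nonZero⁻¹ m (0∣⇒≡0 d∣m) }

    -- The quotient of p n by p d is that of n by d, so the Möbius factors are unchanged.
    Σℤ-multiples : Σℤ (map (p *_) (divisors n)) (μ*-term A (p * n)) ≡ μ* (A ∘ (p *_)) n
    Σℤ-multiples = begin
      Σℤ (map (p *_) (divisors n)) (μ*-term A (p * n))
        ≡⟨ cong (foldr ℤ._+_ 0ℤ) (map-∘ (divisors n)) ⟨
      Σℤ (divisors n) (λ d → μ*-term A (p * n) (p * d))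
        ≡⟨ Σℤ-cong (divisors n) (term ∘ ∈-divisors⁻ {n}) ⟩
      Σℤ (divisors n) (μ*-term (A ∘ (p *_)) n)
        ≡⟨ μ*≡Σ (A ∘ (p *_)) n ⟨
      μ* (A ∘ (p *_)) n ∎
      where
      open ≡-Reasoning

      term : ∀ {d} → d ∣ n → μ*-term A (p * n) (p * d) ≡ μ*-term (A ∘ (p *_)) n d
      term {d} d∣n@(divides c eq) = begin
        μ*-term A (p * n) (p * d)       ≡⟨ cong (λ m → μ*-term A m (p * d)) (trans (cong (p *_) eq) (*-x∙yz≈y∙xz p c d)) ⟩
        μ*-term A (c * (p * d)) (p * d) ≡⟨ μ*-term-* A c (p * d) {{m*n≢0 p d {{p≢0}} {{∣n⇒≢0 d∣n}}}} ⟩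
        μ c ℤ.* A (p * d)               ≡⟨ μ*-term-* (A ∘ (p *_)) c d {{∣n⇒≢0 d∣n}} ⟨
        μ*-term (A ∘ (p *_)) (c * d) d  ≡⟨ cong (λ m → μ*-term (A ∘ (p *_)) m d) eq ⟨
        μ*-term (A ∘ (p *_)) n d        ∎

    μ*-split : μ* A (p * n) ≡ μ* (A ∘ (p *_)) n ℤ.+ Σℤ (coprimeDivisors n) (μ*-term A (p * n))
    μ*-split = begin
      μ* A (p * n)                               ≡⟨ μ*≡Σ A (p * n) ⟩
      Σℤ (divisors (p * n)) (μ*-term A (p * n))  ≡⟨ Σℤ-↭ (divisors-* n) _ ⟩
      Σℤ (map (p *_) (divisors n) ++ coprimeDivisors n) (μ*-term A (p * n))
        ≡⟨ Σℤ-++ (map (p *_) (divisors n)) (coprimeDivisors n) _ ⟩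
      Σℤ (map (p *_) (divisors n)) (μ*-term A (p * n)) ℤ.+ Σℤ (coprimeDivisors n) (μ*-term A (p * n))
        ≡⟨ cong (ℤ._+ Σℤ (coprimeDivisors n) (μ*-term A (p * n))) Σℤ-multiples ⟩
      μ* (A ∘ (p *_)) n ℤ.+ Σℤ (coprimeDivisors n) (μ*-term A (p * n)) ∎
      where open ≡-Reasoning

    -- For d prime to p the quotient p n / d is divisible by p², so its Möbius value is 0 and only
    -- the multiples of p contribute.
    μ*-∣ : p ∣ n → μ* A (p * n) ≡ μ* (A ∘ (p *_)) n
    μ*-∣ p∣n = trans μ*-split (trans (cong (ℤ._+_ (μ* (A ∘ (p *_)) n))
      (trans (Σℤ-cong (coprimeDivisors n) (term ∘ ∈-coprimeDivisors⁻ {n})) (Σℤ-zero (coprimeDivisors n))))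
      (ℤ.+-identityʳ (μ* (A ∘ (p *_)) n)))
      where
      term : ∀ {d} → d ∣ p * n × p ∤ d → μ*-term A (p * n) d ≡ 0ℤ
      term {d} (d∣pn@(divides c eq) , p∤d) = begin
        μ*-term A (p * n) d ≡⟨ cong (λ m → μ*-term A m d) eq ⟩
        μ*-term A (c * d) d ≡⟨ μ*-term-* A c d {{∣n⇒≢0 d∣pn}} ⟩
        μ c ℤ.* A d         ≡⟨ cong (ℤ._* A d) (μ-square {{∣n⇒≢0 (divides d (trans eq (*-comm c d)))}} pp pp∣c) ⟩
        0ℤ ℤ.* A d          ≡⟨ ℤ.*-zeroˡ (A d) ⟩
        0ℤ                  ∎
        where
        open ≡-Reasoning
        p² : p ^ 2 ≡ p * p
        p² = cong (p *_) (*-identityʳ p)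

        pp∣c : p * p ∣ c
        pp∣c = subst (_∣ c) p² (^∣*⇒^∣ pp p∤d 2
          (subst (p ^ 2 ∣_) (trans eq (*-comm c d)) (subst (_∣ p * n) (sym p²) (*-monoʳ-∣ p p∣n))))

    -- The divisors of p n prime to p are now those of n, and their quotients gain one factor p,
    -- which flips the sign of `μ`.
    μ*-∤ : p ∤ n → μ* A (p * n) ≡ μ* (A ∘ (p *_)) n ℤ.- μ* A n
    μ*-∤ p∤n = trans μ*-split (cong (ℤ._+_ (μ* (A ∘ (p *_)) n)) (begin
      Σℤ (coprimeDivisors n) (μ*-term A (p * n)) ≡⟨ Σℤ-↭ (coprimeDivisors-∤ n p∤n) _ ⟩
      Σℤ (divisors n) (μ*-term A (p * n))        ≡⟨ Σℤ-cong (divisors n) (term ∘ ∈-divisors⁻ {n}) ⟩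
      Σℤ (divisors n) (λ d → -1ℤ ℤ.* μ*-term A n d) ≡⟨ Σℤ-*ˡ -1ℤ (divisors n) _ ⟩
      -1ℤ ℤ.* Σℤ (divisors n) (μ*-term A n)      ≡⟨ ℤ.-1*i≡-i _ ⟩
      ℤ.- Σℤ (divisors n) (μ*-term A n)          ≡⟨ cong ℤ.-_ (μ*≡Σ A n) ⟨
      ℤ.- μ* A n ∎))
      where
      open ≡-Reasoning

      neg : ∀ a b → (ℤ.- a) ℤ.* b ≡ -1ℤ ℤ.* (a ℤ.* b)
      neg = ℤ-Solver.solve-∀

      term : ∀ {d} → d ∣ n → μ*-term A (p * n) d ≡ -1ℤ ℤ.* μ*-term A n d
      term {d} d∣n@(divides c eq) = begin
        μ*-term A (p * n) d         ≡⟨ cong (λ m → μ*-term A m d) (trans (cong (p *_) eq) (sym (*-assoc p c d))) ⟩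
        μ*-term A (p * c * d) d     ≡⟨ μ*-term-* A (p * c) d {{∣n⇒≢0 d∣n}} ⟩
        μ (p * c) ℤ.* A d           ≡⟨ cong (ℤ._* A d) (μ-* pp {{∣n⇒≢0 c∣n}} λ p∣c → p∤n (∣-trans p∣c c∣n)) ⟩
        (ℤ.- μ c) ℤ.* A d           ≡⟨ neg (μ c) (A d) ⟩
        -1ℤ ℤ.* (μ c ℤ.* A d)       ≡⟨ cong (-1ℤ ℤ.*_) (μ*-term-* A c d {{∣n⇒≢0 d∣n}}) ⟨
        -1ℤ ℤ.* μ*-term A (c * d) d ≡⟨ cong (λ m → -1ℤ ℤ.* μ*-term A m d) eq ⟨
        -1ℤ ℤ.* μ*-term A n d       ∎
        where
        c∣n : c ∣ n
        c∣n = divides d (trans eq (*-comm c d))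

  -- Factors p are peeled off by `μ*-∣`, each replacing A by `A ∘ (p *_)`, until the last one, where
  -- `μ*-∤` produces the difference.
  μ*-^ : ∀ e A m .{{_ : NonZero m}} → p ∤ m →
         μ* A (p ^ suc e * m) ≡ μ* (λ d → A (p ^ suc e * d) ℤ.- A (p ^ e * d)) m
  μ*-^ zero A m p∤m = begin
    μ* A (p * 1 * m)              ≡⟨ cong (λ q → μ* A (q * m)) (*-identityʳ p) ⟩
    μ* A (p * m)                  ≡⟨ μ*-∤ A m p∤m ⟩
    μ* (A ∘ (p *_)) m ℤ.- μ* A m  ≡⟨ μ*-- (A ∘ (p *_)) A m ⟨
    μ* (λ d → A (p * d) ℤ.- A d) m
      ≡⟨ μ*-cong m (λ d → cong₂ (λ x y → A x ℤ.- A y) (cong (_* d) (sym (*-identityʳ p))) (sym (*-identityˡ d))) ⟩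
    μ* (λ d → A (p * 1 * d) ℤ.- A (1 * d)) m ∎
    where open ≡-Reasoning
  μ*-^ (suc e) A m p∤m = begin
    μ* A (p ^ suc (suc e) * m)      ≡⟨ cong (μ* A) (*-assoc p (p ^ suc e) m) ⟩
    μ* A (p * (p ^ suc e * m))      ≡⟨ μ*-∣ A (p ^ suc e * m) {{m*n≢0 (p ^ suc e) m {{m^n≢0 p (suc e)}}}}
                                         (∣-trans (m∣m*n (p ^ e)) (m∣m*n m)) ⟩
    μ* (A ∘ (p *_)) (p ^ suc e * m) ≡⟨ μ*-^ e (A ∘ (p *_)) m p∤m ⟩
    μ* (λ d → A (p * (p ^ suc e * d)) ℤ.- A (p * (p ^ e * d))) m
      ≡⟨ μ*-cong m (λ d → cong₂ (λ x y → A x ℤ.- A y) (sym (*-assoc p (p ^ suc e) d)) (sym (*-assoc p (p ^ e) d))) ⟩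
    μ* (λ d → A (p ^ suc (suc e) * d) ℤ.- A (p ^ suc e * d)) m ∎
    where open ≡-Reasoning

-- Congruences for powers

-- The part of (1 + x)ⁿ of degree below m. Truncation lets `fermat` split off the terms of degree 0
-- and p.
binomialSum : ℕ → ℤ → ℕ → ℤ
binomialSum n x zero    = 0ℤ
binomialSum n x (suc m) = binomialSum n x m ℤ.+ + (n C m) ℤ.* x ℤ.^ m

binomialSum-pascal : ∀ n x m → binomialSum (suc n) x (suc m) ≡ binomialSum n x (suc m) ℤ.+ x ℤ.* binomialSum n x m
binomialSum-pascal n x zero    = sym (trans (cong (ℤ._+_ 1ℤ) (ℤ.*-zeroʳ x)) refl)
binomialSum-pascal n x (suc m) = begin
  binomialSum (suc n) x (suc m) ℤ.+ + (suc n C suc m) ℤ.* x ℤ.^ suc m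
    ≡⟨ cong₂ (λ a b → a ℤ.+ + b ℤ.* x ℤ.^ suc m) (binomialSum-pascal n x m) (sym (nCk+nC[k+1]≡[n+1]C[k+1] n m)) ⟩
  binomialSum n x (suc m) ℤ.+ x ℤ.* binomialSum n x m ℤ.+ (+ (n C m) ℤ.+ + (n C suc m)) ℤ.* (x ℤ.* x ℤ.^ m)
    ≡⟨ rearrange (binomialSum n x (suc m)) (binomialSum n x m) x (+ (n C m)) (+ (n C suc m)) (x ℤ.^ m) ⟩
  binomialSum n x (suc (suc m)) ℤ.+ x ℤ.* binomialSum n x (suc m) ∎
  where
  open ≡-Reasoning
  rearrange : ∀ a b x c d y → a ℤ.+ x ℤ.* b ℤ.+ (c ℤ.+ d) ℤ.* (x ℤ.* y)
                            ≡ a ℤ.+ d ℤ.* (x ℤ.* y) ℤ.+ x ℤ.* (b ℤ.+ c ℤ.* y)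
  rearrange = ℤ-Solver.solve-∀

binomialTheorem : ∀ n x → binomialSum n x (suc n) ≡ (1ℤ ℤ.+ x) ℤ.^ n
binomialTheorem zero    x = refl
binomialTheorem (suc n) x = begin
  binomialSum (suc n) x (suc (suc n))
    ≡⟨ binomialSum-pascal n x (suc n) ⟩
  s ℤ.+ + (n C suc n) ℤ.* x ℤ.^ suc n ℤ.+ x ℤ.* s
    ≡⟨ cong (λ c → s ℤ.+ + c ℤ.* x ℤ.^ suc n ℤ.+ x ℤ.* s) (k>n⇒nCk≡0 (n<1+n n)) ⟩
  s ℤ.+ 0ℤ ℤ.* x ℤ.^ suc n ℤ.+ x ℤ.* s
    ≡⟨ rearrange s x (x ℤ.^ suc n) ⟩
  (1ℤ ℤ.+ x) ℤ.* s
    ≡⟨ cong ((1ℤ ℤ.+ x) ℤ.*_) (binomialTheorem n x) ⟩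
  (1ℤ ℤ.+ x) ℤ.^ suc n ∎
  where
  open ≡-Reasoning
  s = binomialSum n x (suc n)

  rearrange : ∀ s x y → s ℤ.+ 0ℤ ℤ.* y ℤ.+ x ℤ.* s ≡ (1ℤ ℤ.+ x) ℤ.* s
  rearrange = ℤ-Solver.solve-∀

prime∤! : ∀ {p} → Prime p → ∀ m → m < p → p ∤ m !
prime∤! pp zero    _   p∣1 = contradiction (subst Prime (∣1⇒≡1 p∣1) pp) ¬prime[1]
prime∤! pp (suc m) m<p p∣ with euclidsLemma (suc m) (m !) pp p∣
... | inj₁ p∣1+m = <⇒≱ m<p (∣⇒≤ p∣1+m)
... | inj₂ p∣m!  = prime∤! pp m (<-trans (n<1+n m) m<p) p∣m!

prime∣C : ∀ {p} → Prime p → ∀ m → 0 < m → m < p → p ∣ p C m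
prime∣C {p@(suc p-1)} pp m@(suc m-1) 0<m m<p with euclidsLemma (p C m) (m ! * (p ∸ m) !) pp p∣prod
  where
  instance
    _ = m !* (p ∸ m) !≢0

  p∣prod : p ∣ (p C m) * (m ! * (p ∸ m) !)
  p∣prod = subst (p ∣_) (sym (trans (cong (_* (m ! * (p ∸ m) !)) (nCk≡n!/k![n-k]! (<⇒≤ m<p)))
                                    (m/n*n≡m (k![n∸k]!∣n! (<⇒≤ m<p)))))
                 (m∣m*n (p-1 !))
... | inj₁ p∣C = p∣C
... | inj₂ p∣! with euclidsLemma (m !) ((p ∸ m) !) pp p∣!
...   | inj₁ p∣m! = contradiction p∣m! (prime∤! pp m m<p)
...   | inj₂ p∣[p-m]! = contradiction p∣[p-m]! (prime∤! pp (p ∸ m) (s≤s (m∸n≤m p-1 m-1)))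

binomialSum-prime : ∀ {p} → Prime p → ∀ x m → m < p → + p ∣ᶻ binomialSum p x (suc m) ℤ.- 1ℤ
binomialSum-prime {p} pp x zero    _   = ∣ᶻ.divides 0ℤ refl
binomialSum-prime {p} pp x (suc m) m<p = subst (+ p ∣ᶻ_)
  (rearrange (binomialSum p x (suc m)) (+ (p C suc m) ℤ.* x ℤ.^ suc m))
  (∣ᶻ.∣m∣n⇒∣m+n (binomialSum-prime pp x m (<-trans (n<1+n m) m<p))
    (∣ᶻ.∣m⇒∣m*n {m = + (p C suc m)} (x ℤ.^ suc m) (∣ᶻ.∣ᵤ⇒∣ (prime∣C pp (suc m) (s≤s z≤n) m<p))))
  where
  rearrange : ∀ a b → a ℤ.- 1ℤ ℤ.+ b ≡ a ℤ.+ b ℤ.- 1ℤ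
  rearrange = ℤ-Solver.solve-∀

fermat : ∀ {p} → Prime p → ∀ a → + p ∣ᶻ (+ a) ℤ.^ p ℤ.- + a
fermat {p@(suc p-1)} pp zero    = ∣ᶻ.divides 0ℤ refl
fermat {p@(suc p-1)} pp (suc a) = subst (+ p ∣ᶻ_) eq
  (∣ᶻ.∣m∣n⇒∣m+n (binomialSum-prime pp x p-1 (n<1+n p-1)) (fermat pp a))
  where
  open ≡-Reasoning
  x = + a

  rearrange : ∀ s y x → s ℤ.- 1ℤ ℤ.+ (y ℤ.- x) ≡ s ℤ.+ 1ℤ ℤ.* y ℤ.- (1ℤ ℤ.+ x)
  rearrange = ℤ-Solver.solve-∀

  eq : binomialSum p x p ℤ.- 1ℤ ℤ.+ (x ℤ.^ p ℤ.- x) ≡ (1ℤ ℤ.+ x) ℤ.^ p ℤ.- (1ℤ ℤ.+ x)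
  eq = begin
    binomialSum p x p ℤ.- 1ℤ ℤ.+ (x ℤ.^ p ℤ.- x)          ≡⟨ rearrange (binomialSum p x p) (x ℤ.^ p) x ⟩
    binomialSum p x p ℤ.+ 1ℤ ℤ.* x ℤ.^ p ℤ.- (1ℤ ℤ.+ x)
      ≡⟨ cong (λ c → binomialSum p x p ℤ.+ + c ℤ.* x ℤ.^ p ℤ.- (1ℤ ℤ.+ x)) (nCn≡1 p) ⟨
    binomialSum p x (suc p) ℤ.- (1ℤ ℤ.+ x)                ≡⟨ cong (ℤ._- (1ℤ ℤ.+ x)) (binomialTheorem p x) ⟩
    (1ℤ ℤ.+ x) ℤ.^ p ℤ.- (1ℤ ℤ.+ x)                       ∎

-- (uⁿ − vⁿ) / (u − v)
geometric : ℤ → ℤ → ℕ → ℤ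
geometric u v zero    = 0ℤ
geometric u v (suc n) = u ℤ.* geometric u v n ℤ.+ v ℤ.^ n

geometric-* : ∀ u v n → (u ℤ.- v) ℤ.* geometric u v n ≡ u ℤ.^ n ℤ.- v ℤ.^ n
geometric-* u v zero    = ℤ.*-zeroʳ (u ℤ.- v)
geometric-* u v (suc n) = begin
  (u ℤ.- v) ℤ.* (u ℤ.* geometric u v n ℤ.+ v ℤ.^ n)             ≡⟨ expand u v (geometric u v n) (v ℤ.^ n) ⟩
  u ℤ.* ((u ℤ.- v) ℤ.* geometric u v n) ℤ.+ (u ℤ.- v) ℤ.* v ℤ.^ n
    ≡⟨ cong (λ z → u ℤ.* z ℤ.+ (u ℤ.- v) ℤ.* v ℤ.^ n) (geometric-* u v n) ⟩
  u ℤ.* (u ℤ.^ n ℤ.- v ℤ.^ n) ℤ.+ (u ℤ.- v) ℤ.* v ℤ.^ n         ≡⟨ collect u v (u ℤ.^ n) (v ℤ.^ n) ⟩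
  u ℤ.^ suc n ℤ.- v ℤ.^ suc n                                   ∎
  where
  open ≡-Reasoning
  expand : ∀ u v g w → (u ℤ.- v) ℤ.* (u ℤ.* g ℤ.+ w) ≡ u ℤ.* ((u ℤ.- v) ℤ.* g) ℤ.+ (u ℤ.- v) ℤ.* w
  expand = ℤ-Solver.solve-∀

  collect : ∀ u v a b → u ℤ.* (a ℤ.- b) ℤ.+ (u ℤ.- v) ℤ.* b ≡ u ℤ.* a ℤ.- v ℤ.* b
  collect = ℤ-Solver.solve-∀

-- Modulo t the numbers u and v agree, so each of the n + 1 monomials of the quotient becomes vⁿ.
geometric-≡ : ∀ {t} u v → t ∣ᶻ u ℤ.- v → ∀ n → t ∣ᶻ geometric u v (suc n) ℤ.- + suc n ℤ.* v ℤ.^ n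
geometric-≡ {t} u v t∣ zero = subst (t ∣ᶻ_) (sym (zero-eq u)) (∣ᶻ.divides 0ℤ refl)
  where
  zero-eq : ∀ u → u ℤ.* 0ℤ ℤ.+ 1ℤ ℤ.- 1ℤ ℤ.* 1ℤ ≡ 0ℤ
  zero-eq = ℤ-Solver.solve-∀
geometric-≡ {t} u v t∣ (suc n) = subst (t ∣ᶻ_)
  (rearrange u v (geometric u v (suc n)) (+ suc n) (v ℤ.^ n))
  (∣ᶻ.∣m∣n⇒∣m+n (∣ᶻ.∣n⇒∣m*n v (geometric-≡ u v t∣ n)) (∣ᶻ.∣m⇒∣m*n (geometric u v (suc n)) t∣))
  where
  rearrange : ∀ u v g k w → v ℤ.* (g ℤ.- k ℤ.* w) ℤ.+ (u ℤ.- v) ℤ.* g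
                          ≡ u ℤ.* g ℤ.+ v ℤ.* w ℤ.- (1ℤ ℤ.+ k) ℤ.* (v ℤ.* w)
  rearrange = ℤ-Solver.solve-∀

-- In uᵖ - vᵖ the factor u - v supplies q. The cofactor is a sum of p terms, each congruent to vᵖ⁻¹
-- modulo p, and supplies the extra p.
^-lift : ∀ {p u v q} .{{_ : NonZero p}} → + p ∣ᶻ q → q ∣ᶻ u ℤ.- v → + p ℤ.* q ∣ᶻ u ℤ.^ p ℤ.- v ℤ.^ p
^-lift {p@(suc n)} {u} {v} {q} p∣q q∣ = subst (+ p ℤ.* q ∣ᶻ_)
  (trans (ℤ.*-comm (geometric u v p) (u ℤ.- v)) (geometric-* u v p))
  (∣ᶻ.∣-trans (∣ᶻ.*-monoˡ-∣ q p∣geometric) (∣ᶻ.*-monoʳ-∣ (geometric u v p) q∣))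
  where
  cancel : ∀ g k → g ℤ.- k ℤ.+ k ≡ g
  cancel = ℤ-Solver.solve-∀

  p∣geometric : + p ∣ᶻ geometric u v p
  p∣geometric = subst (+ p ∣ᶻ_) (cancel (geometric u v p) (+ p ℤ.* v ℤ.^ n))
    (∣ᶻ.∣m∣n⇒∣m+n (geometric-≡ u v (∣ᶻ.∣-trans p∣q q∣) n) (∣ᶻ.∣m⇒∣m*n (v ℤ.^ n) ∣ᶻ.∣-refl))

-- Fermat's congruence is the start, and every p-th power gains one more factor p by `^-lift`. In
-- this form it covers multiples of p as well.
euler : ∀ {p} → Prime p → ∀ e a → + (p ^ suc e) ∣ᶻ (+ a) ℤ.^ (p ^ suc e) ℤ.- (+ a) ℤ.^ (p ^ e)
euler {p} pp zero a = subst (λ q → + q ∣ᶻ (+ a) ℤ.^ q ℤ.- (+ a) ℤ.^ 1) (sym (*-identityʳ p))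
  (subst (λ z → + p ∣ᶻ (+ a) ℤ.^ p ℤ.- z) (sym (ℤ.^-identityʳ (+ a))) (fermat pp a))
euler {p} pp (suc e) a = subst₂ _∣ᶻ_ (sym (ℤ.pos-* p (p ^ suc e)))
  (cong₂ ℤ._-_ (pow (p ^ suc e)) (pow (p ^ e)))
  (^-lift {{prime⇒nonZero pp}} (∣ᶻ.∣ᵤ⇒∣ (m∣m*n (p ^ e))) (euler pp e a))
  where
  pow : ∀ m → ((+ a) ℤ.^ m) ℤ.^ p ≡ (+ a) ℤ.^ (p * m)
  pow m = trans (ℤ.^-*-assoc (+ a) m p) (cong ((+ a) ℤ.^_) (*-comm m p))

-- The Dold condition

SignedDold : Sequence → Set
SignedDold A = ∀ n .{{_ : NonZero n}} → + n ∣ᶻ μ* A n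

SignedDold-cong : ∀ {A B} → (∀ n .{{_ : NonZero n}} → A n ≡ B n) → SignedDold A → SignedDold B
SignedDold-cong A≡B dold n = subst (+ n ∣ᶻ_) (μ*-cong n A≡B) (dold n)

∣-Σℤ : ∀ {t} xs {f : ℕ → ℤ} → (∀ x → t ∣ᶻ f x) → t ∣ᶻ Σℤ xs f
∣-Σℤ []       t∣f = ∣ᶻ.divides 0ℤ refl
∣-Σℤ (x ∷ xs) t∣f = ∣ᶻ.∣m∣n⇒∣m+n (t∣f x) (∣-Σℤ xs t∣f)

∣-μ* : ∀ {t A} → (∀ n → t ∣ᶻ A n) → ∀ n → t ∣ᶻ μ* A n
∣-μ* t∣A n = ∣-Σℤ (filter (λ i → suc i ∣? n) (upTo n)) (λ i → ∣ᶻ.∣n⇒∣m*n (μ (n / suc i)) (t∣A (suc i)))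

-- It suffices to test the exact power pᵛ in n = pᵛ m. By `μ*-^` the value at n is the transform at
-- m of differences that are all divisible by pᵛ.
primePowers⇒SignedDold : ∀ A →
  (∀ {p} → Prime p → ∀ e d → + (p ^ suc e) ∣ᶻ A (p ^ suc e * d) ℤ.- A (p ^ e * d)) → SignedDold A
primePowers⇒SignedDold A A≡ n = ∣ᶻ.∣ᵤ⇒∣ (primePowers-∣ _ n (>-nonZero⁻¹ n) at)
  where
  exact : ∀ {p} → Prime p → ∀ v m .{{_ : NonZero m}} → p ∤ m → + (p ^ v) ∣ᶻ μ* A (p ^ v * m)
  exact pp zero    m p∤m = ∣ᶻ.divides (μ* A (1 * m)) (sym (ℤ.*-identityʳ (μ* A (1 * m))))
  exact {p} pp (suc e) m p∤m = subst (+ (p ^ suc e) ∣ᶻ_) (sym (μ*-^ pp e A m p∤m)) (∣-μ* (A≡ pp e) m)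

  at : ∀ p e → Prime p → p ^ e ∣ n → p ^ e ∣ ℤ.∣ μ* A n ∣
  at p e pp pᵉ∣n with strip pp n (>-nonZero⁻¹ n)
  ... | v , m , 0<m , refl , p∤m = ∣-trans
    (^∣*⇒^∣ pp p∤m e (subst (p ^ e ∣_) (*-comm (p ^ v) m) pᵉ∣n))
    (∣ᶻ.∣⇒∣ᵤ (exact pp v m {{>-nonZero 0<m}} p∤m))

pos-^ : ∀ x n → + (x ^ n) ≡ (+ x) ℤ.^ n
pos-^ x zero    = refl
pos-^ x (suc n) = trans (ℤ.pos-* x (x ^ n)) (cong (+ x ℤ.*_) (pos-^ x n))

-- Euler's congruence is applied to the base xᵈ; the shift only multiplies the difference by xᴶ.
SignedDold-^ : ∀ x J → SignedDold (λ n → (+ x) ℤ.^ (n + J))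
SignedDold-^ x J = primePowers⇒SignedDold (λ n → (+ x) ℤ.^ (n + J)) λ {p} pp e d →
  subst (+ (p ^ suc e) ∣ᶻ_) (eq (p ^ suc e) (p ^ e) d) (∣ᶻ.∣m⇒∣m*n ((+ x) ℤ.^ J) (euler pp e (x ^ d)))
  where
  open ≡-Reasoning
  pow : ∀ d m → (+ (x ^ d)) ℤ.^ m ≡ (+ x) ℤ.^ (m * d)
  pow d m = begin
    (+ (x ^ d)) ℤ.^ m       ≡⟨ cong (ℤ._^ m) (pos-^ x d) ⟩
    ((+ x) ℤ.^ d) ℤ.^ m     ≡⟨ ℤ.^-*-assoc (+ x) d m ⟩
    (+ x) ℤ.^ (d * m)       ≡⟨ cong ((+ x) ℤ.^_) (*-comm d m) ⟩
    (+ x) ℤ.^ (m * d)       ∎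

  distrib : ∀ a b c → (a ℤ.- b) ℤ.* c ≡ a ℤ.* c ℤ.- b ℤ.* c
  distrib = ℤ-Solver.solve-∀

  eq : ∀ m n d → ((+ (x ^ d)) ℤ.^ m ℤ.- (+ (x ^ d)) ℤ.^ n) ℤ.* (+ x) ℤ.^ J
               ≡ (+ x) ℤ.^ (m * d + J) ℤ.- (+ x) ℤ.^ (n * d + J)
  eq m n d = trans (distrib ((+ (x ^ d)) ℤ.^ m) ((+ (x ^ d)) ℤ.^ n) ((+ x) ℤ.^ J)) (cong₂ ℤ._-_ (term m) (term n))
    where
    term : ∀ m → (+ (x ^ d)) ℤ.^ m ℤ.* (+ x) ℤ.^ J ≡ (+ x) ℤ.^ (m * d + J)
    term m = trans (cong (ℤ._* (+ x) ℤ.^ J) (pow d m)) (sym (ℤ.^-distribˡ-+-* (+ x) (m * d) J))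

-- Differences are taken in x while the transform acts on n, so linearity is enough.
SignedDold-Δ : ∀ K (F : ℕ → ℕ → ℤ) → (∀ x → SignedDold (λ n → F n x)) →
               ∀ x → SignedDold (λ n → Δ K (F n) x)
SignedDold-Δ zero    F dold x = dold x
SignedDold-Δ (suc K) F dold x n =
  subst (+ n ∣ᶻ_) (sym (μ*-- (λ n → Δ K (F n) (suc x)) (λ n → Δ K (F n) x) n))
    (∣ᶻ.∣m∣n⇒∣m-n (SignedDold-Δ K F dold (suc x) n) (SignedDold-Δ K F dold x n))

!*S⁽²⁾-SignedDold : ∀ K → SignedDold (λ n → + (K !) ℤ.* S⁽²⁾ (suc K) n)
!*S⁽²⁾-SignedDold K =
  -- The exponent n + K - 1 is `n + pred K` for K ≥ 1. For K = 0 this is one too large, harmlessly,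
  -- since the base is 1.
  SignedDold-cong (eq K) (SignedDold-Δ K (λ n x → (+ x) ℤ.^ (n + pred K)) (λ x → SignedDold-^ x (pred K)) 1)
  where
  eq : ∀ K n .{{_ : NonZero n}} → Δ K (λ x → (+ x) ℤ.^ (n + pred K)) 1 ≡ + (K !) ℤ.* S⁽²⁾ (suc K) n
  eq zero n@(suc m) = trans (ℤ.^-zeroˡ (n + 0))
    (sym (cong (1ℤ ℤ.*_) (trans (S⁽²⁾≡diagonal 0 n) (cong +_ (diagonal-zero m)))))
  eq (suc J) n = trans (sym (!*stirling₂ (suc J) (n + J)))
    (sym (cong (+ (suc J !) ℤ.*_) (trans (S⁽²⁾≡diagonal (suc J) n)
      (cong (λ m → + stirling₂ m (suc (suc J))) (+-suc n J)))))

∣!*μ*-S⁽²⁾ : ∀ K n .{{_ : NonZero n}} → + n ∣ᶻ + (K !) ℤ.* μ* (S⁽²⁾ (suc K)) n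
∣!*μ*-S⁽²⁾ K n = subst (+ n ∣ᶻ_) (μ*-*ˡ (+ (K !)) (S⁽²⁾ (suc K)) n) (!*S⁽²⁾-SignedDold K n)

-- Cancelling the gcd of i and n leaves a denominator that divides m times the numerator; it is
-- coprime to the numerator, so it divides m.
Denom-∣ : ∀ m i n .{{_ : NonZero n}} → + n ∣ᶻ + m ℤ.* i → Denom (i ℚ./ n) ∣ m
Denom-∣ m i n n∣mi = Coprimality.coprime-divisor (Coprimality.sym (coprime (i ℚ./ n)))
  (subst (Denom (i ℚ./ n) ∣_) (trans (ℤ.abs-* (+ m) (ℚ.↥ r)) (*-comm m ℤ.∣ ℚ.↥ r ∣)) (∣ᶻ.∣⇒∣ᵤ ↧∣m↥))
  where
  r = i ℚ./ n
  g = gcd ℤ.∣ i ∣ n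

  coprime : ∀ q → Coprime ℤ.∣ ℚ.↥ q ∣ (Denom q)
  -- Coprimality is an irrelevant field of a rational; it is recovered by deciding it.
  coprime (mkℚ _ _ c) = Coprimality.recompute c

  instance
    g≢0 : NonZero g
    g≢0 = ≢-nonZero (gcd[m,n]≢0 ℤ.∣ i ∣ n (inj₂ (≢-nonZero⁻¹ n)))

  ↧∣m↥ : ℚ.↧ r ∣ᶻ + m ℤ.* ℚ.↥ r
  ↧∣m↥ = ∣ᶻ.*-cancelʳ-∣ (+ g) (subst₂ _∣ᶻ_ (sym (ℚ.↧-/ i n))
    (trans (cong (+ m ℤ.*_) (sym (ℚ.↥-/ i n))) (sym (ℤ.*-assoc (+ m) (ℚ.↥ r) (+ g)))) n∣mi)

!-CommonMultiple : ∀ K → CommonMultiple (S⁽²⁾ (suc K)) (K !)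
!-CommonMultiple K n = Denom-∣ (K !) (μ* (S⁽²⁾ (suc K)) n) n (∣!*μ*-S⁽²⁾ K n)

-- The sign condition

partialSum : (ℕ → ℕ) → ℕ → ℕ
partialSum a zero    = 0
partialSum a (suc m) = partialSum a m + a (suc m)

partialSum-≤ : ∀ {a} → (∀ n → 2 * a n ≤ a (suc n)) → ∀ m → partialSum a m ≤ a (suc m)
partialSum-≤ doubles zero = z≤n
partialSum-≤ {a} doubles (suc m) = begin
  partialSum a m + a (suc m) ≤⟨ +-monoˡ-≤ (a (suc m)) (partialSum-≤ doubles m) ⟩
  a (suc m) + a (suc m)      ≡⟨ cong (a (suc m) ℕ.+_) (+-identityʳ (a (suc m))) ⟨
  2 * a (suc m)              ≤⟨ doubles (suc m) ⟩
  a (suc (suc m))            ∎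
  where open ≤-Reasoning

μ*-bound : ∀ n a → ℤ.- (+ a) ℤ.≤ μ n ℤ.* + a
μ*-bound n a with μ-cases n
... | inj₁ eq        rewrite eq = ℤ.≤-trans (ℤ.neg-≤-pos {a} {0}) (ℤ.≤-reflexive (sym (ℤ.*-zeroˡ (+ a))))
... | inj₂ (inj₁ eq) rewrite eq = ℤ.≤-trans (ℤ.neg-≤-pos {a} {a}) (ℤ.≤-reflexive (sym (ℤ.*-identityˡ (+ a))))
... | inj₂ (inj₂ eq) rewrite eq = ℤ.≤-reflexive (sym (ℤ.-1*i≡-i (+ a)))

-- The terms with d < n are at least −a d, and their sum is outweighed by a n.
doubles⇒Sign : ∀ (a : ℕ → ℕ) → (∀ n → 2 * a n ≤ a (suc n)) → Sign (λ n → + a n)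
doubles⇒Sign a doubles n@(suc m) = begin
  0ℤ                                     ≡⟨ ℤ.+-inverseˡ (+ a n) ⟨
  ℤ.- (+ a n) ℤ.+ + a n                  ≤⟨ ℤ.+-monoˡ-≤ (+ a n) (ℤ.neg-mono-≤ (ℤ.+≤+ (partialSum-≤ doubles m))) ⟩
  ℤ.- (+ partialSum a m) ℤ.+ + a n       ≤⟨ ℤ.+-mono-≤ (lower m) (ℤ.≤-reflexive (sym last)) ⟩
  Σℤ (ds m) t ℤ.+ Σℤ (filter P? (m ∷ [])) t ≡⟨ split m ⟨
  μ* (λ n → + a n) n                     ∎
  where
  open ℤ.≤-Reasoning
  P? = λ i → suc i ∣? n
  t = λ i → μ (n / suc i) ℤ.* + a (suc i)
  ds = λ m → filter P? (upTo m)

  split : ∀ m → Σℤ (ds (suc m)) t ≡ Σℤ (ds m) t ℤ.+ Σℤ (filter P? (m ∷ [])) t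
  split m = trans (cong (λ xs → Σℤ xs t) (trans (cong (filter P?) (sym (upTo-∷ʳ m))) (filter-++ P? (upTo m) (m ∷ []))))
                  (Σℤ-++ (ds m) (filter P? (m ∷ [])) t)

  -- The index m stands for the divisor n itself, whose Möbius factor is μ 1 = 1.
  last : Σℤ (filter P? (m ∷ [])) t ≡ + a n
  last = trans (cong (λ xs → Σℤ xs t) (filter-accept P? {m} {[]} ∣-refl))
    (trans (ℤ.+-identityʳ _) (trans (cong (λ c → μ c ℤ.* + a n) (n/n≡1 n)) (ℤ.*-identityˡ (+ a n))))

  step : ∀ m → ℤ.- (+ a (suc m)) ℤ.≤ Σℤ (filter P? (m ∷ [])) t
  step m = go (P? m)
    where
    go : Dec (suc m ∣ n) → ℤ.- (+ a (suc m)) ℤ.≤ Σℤ (filter P? (m ∷ [])) t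
    go (yes d) = ℤ.≤-trans (μ*-bound (n / suc m) (a (suc m))) (ℤ.≤-reflexive
      (sym (trans (cong (λ xs → Σℤ xs t) (filter-accept P? {m} {[]} d)) (ℤ.+-identityʳ (t m)))))
    go (no ¬d) = ℤ.≤-trans (ℤ.neg-≤-pos {a (suc m)} {0}) (ℤ.≤-reflexive
      (sym (cong (λ xs → Σℤ xs t) (filter-reject P? {m} {[]} ¬d))))

  lower : ∀ m → ℤ.- (+ partialSum a m) ℤ.≤ Σℤ (ds m) t
  lower zero    = ℤ.≤-refl
  lower (suc m) = begin
    ℤ.- (+ (partialSum a m + a (suc m)))            ≡⟨ ℤ.neg-distrib-+ (+ partialSum a m) (+ a (suc m)) ⟩
    ℤ.- (+ partialSum a m) ℤ.+ ℤ.- (+ a (suc m))    ≤⟨ ℤ.+-mono-≤ (lower m) (step m) ⟩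
    Σℤ (ds m) t ℤ.+ Σℤ (filter P? (m ∷ [])) t       ≡⟨ split m ⟨
    Σℤ (ds (suc m)) t                               ∎

-- Write n = p m. If p divides m, the value at n equals that at m; otherwise it is a difference of
-- equal terms, because the constant sequence is unchanged by `_∘ (p *_)`.
Sign-one : Sign (λ _ → 1ℤ)
Sign-one n = <-rec _ go n (>-nonZero⁻¹ n)
  where
  go : ∀ n → (∀ {m} → m < n → 0 < m → 0ℤ ℤ.≤ μ* (λ _ → 1ℤ) m) → 0 < n → 0ℤ ℤ.≤ μ* (λ _ → 1ℤ) n
  go n rec 0<n with m≤n⇒m<n∨m≡n 0<n
  ... | inj₂ refl = ℤ.+≤+ z≤n
  ... | inj₁ 1<n with primeDivisor n 1<n
  ...   | p , pp , divides zero refl = contradiction 0<n λ ()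
  ...   | p , pp , divides m@(suc _) refl with p ∣? m
  ...     | yes p∣m = subst (0ℤ ℤ.≤_) (sym (trans (cong (μ* (λ _ → 1ℤ)) (*-comm m p)) (μ*-∣ pp (λ _ → 1ℤ) m p∣m)))
                        (rec (m<m*n m p (prime>1 pp)) (s≤s z≤n))
  ...     | no p∤m = ℤ.≤-reflexive (sym (trans (cong (μ* (λ _ → 1ℤ)) (*-comm m p))
                       (trans (μ*-∤ pp (λ _ → 1ℤ) m p∤m) (ℤ.+-inverseʳ (μ* (λ _ → 1ℤ) m)))))

Sign-cong : ∀ (A B : Sequence) → (∀ n .{{_ : NonZero n}} → A n ≡ B n) → Sign A → Sign B
Sign-cong A B A≡B sign n = subst (0ℤ ℤ.≤_) (μ*-cong n A≡B) (sign n)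

S⁽²⁾-Sign : ∀ K → Sign (S⁽²⁾ (suc K))
S⁽²⁾-Sign zero    = Sign-cong (λ _ → 1ℤ) (S⁽²⁾ 1)
  (λ { n@(suc m) → sym (trans (S⁽²⁾≡diagonal 0 n) (cong +_ (diagonal-zero m))) }) Sign-one
S⁽²⁾-Sign (suc K) = Sign-cong (λ n → + diagonal (suc K) n) (S⁽²⁾ (suc (suc K)))
  (λ n → sym (S⁽²⁾≡diagonal (suc K) n)) (doubles⇒Sign (diagonal (suc K)) (diagonal-doubles K))

-- Failure of the Dold condition at a power of 2

2∣-⇒parity : ∀ a b → + 2 ∣ᶻ + a ℤ.- + b → parity a ≡ parity b
2∣-⇒parity a b (∣ᶻ.divides (+ k) eq) = sym (parity-+2* a b k (ℤ.+-injective (begin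
  + a                      ≡⟨ cancel (+ a) (+ b) ⟨
  + b ℤ.+ (+ a ℤ.- + b)    ≡⟨ cong (ℤ._+_ (+ b)) (trans eq (sym (ℤ.pos-* k 2))) ⟩
  + (b + k * 2)            ∎)))
  where
  open ≡-Reasoning
  cancel : ∀ a b → b ℤ.+ (a ℤ.- b) ≡ a
  cancel = ℤ-Solver.solve-∀

  parity-+2* : ∀ a b k → a ≡ b + k * 2 → parity b ≡ parity a
  parity-+2* a b k refl = sym (trans (ℙ.+-homo-+ b (k * 2))
    (trans (cong (parity b ℙ.+_) (trans (ℙ.*-homo-* k 2) (ℙ.*-zeroʳ (parity k)))) (ℙ.+-identityʳ (parity b))))
-- Exchanging a and b makes the quotient positive.
2∣-⇒parity a b (∣ᶻ.divides -[1+ k ] eq) =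
  sym (2∣-⇒parity b a (∣ᶻ.divides (+ suc k) (trans (flip (+ a) (+ b)) (trans (cong ℤ.-_ eq)
    (ℤ.neg-distribˡ-* -[1+ k ] (+ 2))))))
  where
  flip : ∀ a b → b ℤ.- a ≡ ℤ.- (a ℤ.- b)
  flip = ℤ-Solver.solve-∀

-- At 2ᵉ⁺¹ the transform has just two terms, the difference of the values at 2ᵉ⁺¹ and 2ᵉ. The Dold
-- condition would make it even, against `parity-jump`.
¬Dold-S⁽²⁾ : ∀ K → 2 ≤ K → ¬ Dold (S⁽²⁾ (suc K))
¬Dold-S⁽²⁾ K 2≤K dold with parity-jump K 2≤K
... | e , jump = jump (sym (2∣-⇒parity (diagonal K (2 ^ suc e)) (diagonal K (2 ^ e))
  (subst (+ 2 ∣ᶻ_) eq (∣ᶻ.∣-trans (∣ᶻ.∣ᵤ⇒∣ {+ 2} {+ (2 ^ suc e)} (m∣m*n (2 ^ e)))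
    (∣ᶻ.∣ᵤ⇒∣ {+ (2 ^ suc e)} (dold (2 ^ suc e) {{m^n≢0 2 (suc e)}}))))))
  where
  open ≡-Reasoning
  S = S⁽²⁾ (suc K)

  μ*-1 : ∀ B → μ* B 1 ≡ B 1
  μ*-1 B = trans (ℤ.+-identityʳ (1ℤ ℤ.* B 1)) (ℤ.*-identityˡ (B 1))

  eq : μ* S (2 ^ suc e) ≡ + diagonal K (2 ^ suc e) ℤ.- + diagonal K (2 ^ e)
  eq = begin
    μ* S (2 ^ suc e)                       ≡⟨ cong (μ* S) (*-identityʳ (2 ^ suc e)) ⟨
    μ* S (2 ^ suc e * 1)                   ≡⟨ μ*-^ prime[2] e S 1 (λ 2∣1 → contradiction (∣1⇒≡1 2∣1) λ ()) ⟩
    μ* (λ d → S (2 ^ suc e * d) ℤ.- S (2 ^ e * d)) 1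
                                           ≡⟨ μ*-1 (λ d → S (2 ^ suc e * d) ℤ.- S (2 ^ e * d)) ⟩
    S (2 ^ suc e * 1) ℤ.- S (2 ^ e * 1)    ≡⟨ cong₂ (λ m n → S m ℤ.- S n) (*-identityʳ (2 ^ suc e)) (*-identityʳ (2 ^ e)) ⟩
    S (2 ^ suc e) ℤ.- S (2 ^ e)            ≡⟨ cong₂ ℤ._-_ (S⁽²⁾≡diagonal K (2 ^ suc e)) (S⁽²⁾≡diagonal K (2 ^ e)) ⟩
    + diagonal K (2 ^ suc e) ℤ.- + diagonal K (2 ^ e) ∎

-- Covers k = 1 and k = 2, as 0! = 1! = 1: there the divisibility of the multiplied transform is the
-- Dold condition itself.
!≡1⇒Dold : ∀ K → K ! ≡ 1 → Dold (S⁽²⁾ (suc K))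
!≡1⇒Dold K K!≡1 n = ∣ᶻ.∣⇒∣ᵤ (subst (+ n ∣ᶻ_)
  (trans (cong (λ m → + m ℤ.* μ* (S⁽²⁾ (suc K)) n) K!≡1) (ℤ.*-identityˡ (μ* (S⁽²⁾ (suc K)) n))) (∣!*μ*-S⁽²⁾ K n))

theorem7 : (∀ k → k ≡ 1 ⊎ k ≡ 2 → Realizable (S⁽²⁾ k)) ×
    (∀ k → 3 ≤ k → ¬ Realizable (S⁽²⁾ k) × AlmostRealizable (S⁽²⁾ k)) ×
    (∀ k → 1 ≤ k → ∀ f → IsFail (S⁽²⁾ k) f → f ∣⁺ (k ∸ 1) !)
theorem7 = realizable , almostRealizable , fail
  where
  realizable : ∀ k → k ≡ 1 ⊎ k ≡ 2 → Realizable (S⁽²⁾ k)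
  realizable _ (inj₁ refl) = !≡1⇒Dold 0 refl , S⁽²⁾-Sign 0
  realizable _ (inj₂ refl) = !≡1⇒Dold 1 refl , S⁽²⁾-Sign 1

  finite : ∀ K → FailFinite (S⁽²⁾ (suc K))
  finite K = K ! , (K !≢0) , !-CommonMultiple K

  almostRealizable : ∀ k → 3 ≤ k → ¬ Realizable (S⁽²⁾ k) × AlmostRealizable (S⁽²⁾ k)
  almostRealizable (suc K) (s≤s 2≤K) = ¬Dold-S⁽²⁾ K 2≤K ∘ proj₁ , finite K , S⁽²⁾-Sign K

  fail : ∀ k → 1 ≤ k → ∀ f → IsFail (S⁽²⁾ k) f → f ∣⁺ (k ∸ 1) !
  fail (suc K) _ [ f ] (_ , _ , least) = least (K !) (!-CommonMultiple K)
  fail (suc K) _ ∞     ¬finite         = ¬finite (finite K)
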